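{- There is a static data structure (called darray) which, for every ordered set $S\subset\{0,1,\ldots,n-1\}$ with $m\ge 1$ elements, stores a representation of $S$ in $n+o(n)$ bits in the worst case, and which, on the word RAM, answers each query $\mathrm{rank}(x,S)$ in $O(1)$ worst-case time and each query $\mathrm{select}(i,S)$ in $O\!\left(1+\frac{\log^4 m}{\log n}\right)$ worst-case time.
   Context: For $S\subset\{0,1,\ldots,n-1\}$: $\mathrm{rank}(x,S)$ is the number of elements of $S$ which are no greater than $x$, and $\mathrm{select}(i,S)$ is the $i$-th smallest element of $S$. Word RAM model: logical and arithmetic operations on two $O(\log n)$-bit integers take constant time, and any consecutive $O(\log n)$ bits of memory at any address can be read or written in constant time. Here $\log^4 m=(\log m)^4$, and the term $o(n)$ is as $n\to\infty$. -}

module Defs where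

open import Data.Bool using (Bool; true; false; if_then_else_; _∧_; _∨_; _xor_)
open import Data.Nat
open import Data.Nat.DivMod using (_/_; _%_)
open import Data.Nat.Logarithm using (⌊log₂_⌋)
open import Data.Nat.Properties using (m^n≢0)
open import Data.Fin as Fin using (Fin; toℕ)
open import Data.Fin.Subset using (Subset; inside; outside; ∣_∣)
open import Data.List as List using (List; length)
open import Data.Product using (∃-syntax; _×_)
open import Data.Vec as Vec using (Vec; []; _∷_)
open import Function using (_∘_)
open import Relation.Binary.PropositionalEquality using (_≡_; _≢_)

------------------------------------------------------------------------
-- Rank and select

-- The elements of S in increasing order.
elements : ∀ {n} (S : Subset n) → Vec (Fin n) ∣ S ∣
elements []            = []
elements (inside  ∷ S) = Fin.zero ∷ Vec.map Fin.suc (elements S)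
elements (outside ∷ S) = Vec.map Fin.suc (elements S)

rank : ∀ {n} → Fin n → Subset n → ℕ
rank x S = Vec.count (Fin._≤? x) (elements S)

-- The index is 0-based here: select i S is the (1 + i)-th smallest element.
select : ∀ {n} (S : Subset n) → Fin ∣ S ∣ → Fin n
select S i = Vec.lookup (elements S) i

------------------------------------------------------------------------
-- Asymptotics

-- f is o(g): for every k, eventually f ≤ g / k.
LittleO : (ℕ → ℕ) → (ℕ → ℕ) → Set
LittleO f g = ∀ k → ∃[ N ] (∀ n → N ≤ n → k * f n ≤ g n)

-- For n ≥ 2 and m ≥ 1 this is within constant factors of
-- 1 + (log m)^4 / log n over the reals; the denominator 1 + ⌊log₂ n⌋ (the bit
-- length of n) also gives the quotient a meaning at n = 1.
selectBound : ℕ → ℕ → ℕ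
selectBound n m = 1 + ⌊log₂ m ⌋ ^ 4 / suc ⌊log₂ n ⌋

------------------------------------------------------------------------
-- Word arithmetic.  A word of w bits is a natural number below 2 ^ w; bits
-- are numbered from the least significant one.

truncate : ℕ → ℕ → ℕ
truncate w x = _%_ x (2 ^ w) {{m^n≢0 2 w}}

testBit : ℕ → ℕ → Bool
testBit x zero    = (x % 2) ≡ᵇ 1
testBit x (suc i) = testBit (x / 2) i

fromBits : ℕ → (ℕ → Bool) → ℕ
fromBits zero    b = 0
fromBits (suc l) b = (if b 0 then 1 else 0) + 2 * fromBits l (b ∘ suc)

bitwise : (Bool → Bool → Bool) → ℕ → ℕ → ℕ → ℕ
bitwise _∙_ w x y = fromBits w (λ i → testBit x i ∙ testBit y i)

data Op : Set where
  ADD SUB MUL DIV MOD AND OR XOR SHL SHR LT EQ : Op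

-- The value of x op y before truncation to w bits.  Subtraction wraps around,
-- division by 0 yields 0 and the remainder modulo 0 is x.
evalOp : ℕ → Op → ℕ → ℕ → ℕ
evalOp w ADD x y       = x + y
evalOp w SUB x y       = x + (2 ^ w ∸ y)
evalOp w MUL x y       = x * y
evalOp w DIV x zero    = 0
evalOp w DIV x (suc y) = x / suc y
evalOp w MOD x zero    = x
evalOp w MOD x (suc y) = x % suc y
evalOp w AND x y       = bitwise _∧_ w x y
evalOp w OR  x y       = bitwise _∨_ w x y
evalOp w XOR x y       = bitwise _xor_ w x y
evalOp w SHL x y       = x * 2 ^ y
evalOp w SHR x y       = _/_ x (2 ^ y) {{m^n≢0 2 y}}
evalOp w LT  x y       = if x <ᵇ y then 1 else 0
evalOp w EQ  x y       = if x ≡ᵇ y then 1 else 0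

------------------------------------------------------------------------
-- The word RAM: registers hold words, the memory is addressed by the bit.

Reg : Set
Reg = ℕ

record State : Set where
  constructor ⟪_,_⟫
  field
    regs : Reg → ℕ
    mem  : ℕ → Bool

open State public

-- In load and store, a holds a bit address and l a number of bits.
data Instr : Set where
  literal  : (r : Reg) (k : ℕ) → Instr
  wordSize : (r : Reg) → Instr
  op       : Op → (r x y : Reg) → Instr
  load     : (r a l : Reg) → Instr
  store    : (a l x : Reg) → Instr

-- A program is a fixed finite text: it can depend neither on n nor on S, and
-- it only mentions finitely many registers.
data Program : Set where
  skip  : Program
  instr : Instr → Program
  _⨾_   : Program → Program → Program
  ifnz  : Reg → Program → Program → Program
  while : Reg → Program → Program

infixr 5 _⨾_

setReg : ℕ → Reg → ℕ → State → State
setReg w r v s = record s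
  { regs = λ r′ → if r′ ≡ᵇ r then truncate w v else regs s r′ }

writeBits : ℕ → ℕ → ℕ → (ℕ → Bool) → ℕ → Bool
writeBits a l x M j =
  if (a ≤ᵇ j) ∧ (j <ᵇ a + l) then testBit x (j ∸ a) else M j

-- One instruction transfers at most w consecutive bits, hence l ⊓ w.
exec : ℕ → Instr → State → State
exec w (literal r k)  s = setReg w r k s
exec w (wordSize r)   s = setReg w r w s
exec w (op o r x y)   s = setReg w r (evalOp w o (regs s x) (regs s y)) s
exec w (load r a l)   s =
  setReg w r (fromBits (regs s l ⊓ w) (λ i → mem s (regs s a + i))) s
exec w (store a l x)  s = record s
  { mem = writeBits (regs s a) (regs s l ⊓ w) (regs s x) (mem s) }

-- w ⊢ p , s ⇓[ t ] s′ : with word size w, program p started in s halts in s′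
-- after t steps; every instruction and every test is one step.
data _⊢_,_⇓[_]_ (w : ℕ) : Program → State → ℕ → State → Set where
  skip    : ∀ {s} → w ⊢ skip , s ⇓[ 1 ] s
  instr   : ∀ {i s} → w ⊢ instr i , s ⇓[ 1 ] exec w i s
  seq     : ∀ {p q s s′ s″ t t′} →
            w ⊢ p , s ⇓[ t ] s′ → w ⊢ q , s′ ⇓[ t′ ] s″ →
            w ⊢ p ⨾ q , s ⇓[ t + t′ ] s″
  ifTrue  : ∀ {r p q s s′ t} → regs s r ≢ 0 →
            w ⊢ p , s ⇓[ t ] s′ → w ⊢ ifnz r p q , s ⇓[ 1 + t ] s′
  ifFalse : ∀ {r p q s s′ t} → regs s r ≡ 0 →
            w ⊢ q , s ⇓[ t ] s′ → w ⊢ ifnz r p q , s ⇓[ 1 + t ] s′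
  loop    : ∀ {r p s s′ s″ t t′} → regs s r ≢ 0 →
            w ⊢ p , s ⇓[ t ] s′ → w ⊢ while r p , s′ ⇓[ t′ ] s″ →
            w ⊢ while r p , s ⇓[ 1 + (t + t′) ] s″
  done    : ∀ {r p s} → regs s r ≡ 0 → w ⊢ while r p , s ⇓[ 1 ] s

Holds : (ℕ → Bool) → List Bool → Set
Holds M bs = ∀ (i : Fin (length bs)) → M (toℕ i) ≡ List.lookup bs i

-- The query argument q is in register 0 and all other registers are 0.
initial : ℕ → ℕ → (ℕ → Bool) → State
initial w q M = setReg w 0 q ⟪ (λ _ → 0) , M ⟫

-- On every memory that starts with the bits bs, program p with argument q
-- halts within T steps with the answer a in register 0.  The bits after bs are
-- arbitrary (scratch space), and bs is intact afterwards, so that queries can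
-- be repeated.
Answers : (w : ℕ) (p : Program) (bs : List Bool) (q a T : ℕ) → Set
Answers w p bs q a T =
  ∀ M → Holds M bs →
  ∃[ t ] ∃[ s ] (t ≤ T × w ⊢ p , initial w q M ⇓[ t ] s ×
                 regs s 0 ≡ a × Holds (mem s) bs)

------------------------------------------------------------------------
-- Static data structures for subsets of {0, …, n-1}

record DataStructure : Set where
  field
    -- Words have wordFactor * (1 + ⌊log₂ n⌋) = O(log n) bits.
    wordFactor : ℕ
    encode     : ∀ {n} → Subset n → List Bool
    rankProg   : Program
    selectProg : Program

  wordBits : ℕ → ℕ
  wordBits n = wordFactor * suc ⌊log₂ n ⌋

  AnswersRank : ∀ {n} → Subset n → Fin n → (T : ℕ) → Set
  AnswersRank {n} S x T =
    Answers (wordBits n) rankProg (encode S) (toℕ x) (rank x S) T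

  -- The program receives the 1-based index of the element.
  AnswersSelect : ∀ {n} (S : Subset n) → Fin ∣ S ∣ → (T : ℕ) → Set
  AnswersSelect {n} S i T =
    Answers (wordBits n) selectProg (encode S) (suc (toℕ i))
            (toℕ (select S i)) T

{-# OPTIONS --safe #-}

-- Write L = ⌊log₂ n⌋ + 1 and m = |S|.  Rank is answered by a two-level directory
-- over the bit vector of S: an absolute count of L bits per superblock of L
-- blocks, an offset of O(log L) bits per block of about L / 2 bits, and a table
-- of all popcounts of a block.  For select: if
-- (log m)² ≥ L, then L ≤ (log m)⁴ / L, and a binary search of L constant-time
-- ranks is within the bound.  If (log m)² < L, then log m ≤ L / 2, so the m
-- positions can be tabulated explicitly in O(√n log n) bits.
module Submission where

open import Defs
open import Data.Nat
open import Data.Nat.Properties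
open import Data.Nat.DivMod
open import Data.Nat.Logarithm
  using (⌊log₂_⌋; ⌊log₂⌋-mono-≤; ⌊log₂[2^n]⌋≡n; ⌊log₂⌊n/2⌋⌋≡⌊log₂n⌋∸1)
open import Data.Nat.Divisibility using (m∣m*n)
open import Data.Nat.Induction using (<-rec)
open import Data.Nat.Solver using (module +-*-Solver)
open import Data.Empty using (⊥)
open import Data.Bool using (Bool; true; false; if_then_else_; T)
open import Data.Fin as Fin using (Fin; toℕ)
open import Data.Fin.Properties using (toℕ<n; toℕ-injective)
open import Data.Fin.Subset using (Subset; ∣_∣; inside; outside)
open import Data.Fin.Subset.Properties using (∣p∣≤n)
open import Data.List as List using (List; []; _∷_; _++_; length)
open import Data.List.Properties using (length-++)
open import Data.Product using (Σ-syntax; ∃-syntax; _×_; _,_; proj₁; proj₂)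
open import Data.Unit using (⊤; tt)
open import Data.Vec as Vec using (Vec; []; _∷_; lookup; _[_]≔_)
open import Data.Vec.Properties using (length-toList; lookup-map; lookup∘update; lookup∘update′)
open import Function using (_∘_; id)
open import Relation.Nullary using (Dec; yes; no; does; contradiction)
open import Relation.Nullary.Decidable using (True; toWitness)
open import Relation.Binary.PropositionalEquality

-- Expressions over three variables, compiled to straight-line programs

-- The programs are fixed texts, so nothing about `n` can be built into them: `L` is recovered from
-- the word size, and every other parameter is read from a header of ten fields at address 0. Every
-- machine operation truncates, so the main obligation is to exclude overflow; words of `64 * L`
-- bits leave enough slack for exact arithmetic to be certified by adding small degrees. No program
-- contains a `store`, so the memory never changes and the encoding stays intact. Blocks of about
-- `L / 2` bits are the point of balance: the popcount table has on the order of √n entries, the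
-- same bound as for the table of positions, while `O(log L)` bits per block still total only
-- `O(n log L / L)`.

data Exp : Set where
  var  : Fin 3 → Exp
  lit  : ℕ → Exp
  word : Exp
  bin  : Op → Exp → Exp → Exp
  peek : Exp → Exp → Exp

Env : Set
Env = Vec ℕ 3

-- Truncation follows every operation, exactly as on the machine, so `compile-correct` holds without
-- size bounds; these enter only with `Val`. The clause for `var` reflects that a register is copied
-- by adding it to a literal 0.
⟦_⟧ : Exp → ℕ → (ℕ → Bool) → Env → ℕ
⟦ var i ⟧     w M ρ = truncate w (lookup ρ i + truncate w 0)
⟦ lit k ⟧     w M ρ = truncate w k
⟦ word ⟧      w M ρ = truncate w w
⟦ bin o e f ⟧ w M ρ = truncate w (evalOp w o (⟦ e ⟧ w M ρ) (⟦ f ⟧ w M ρ))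
⟦ peek e f ⟧  w M ρ =
  truncate w (fromBits (⟦ f ⟧ w M ρ ⊓ w) (λ i → M (⟦ e ⟧ w M ρ + i)))

-- The value ends up in register d; the registers above d are scratch.
compile : Reg → Exp → Program
compile d (var i)     = instr (literal d 0) ⨾ instr (op ADD d (toℕ i) d)
compile d (lit k)     = instr (literal d k)
compile d word        = instr (wordSize d)
compile d (bin o e f) = compile d e ⨾ compile (suc d) f ⨾ instr (op o d d (suc d))
compile d (peek e f)  = compile d e ⨾ compile (suc d) f ⨾ instr (load d d (suc d))

cost : Exp → ℕ
cost (var i)     = 2
cost (lit k)     = 1
cost word        = 1
cost (bin o e f) = cost e + (cost f + 1)
cost (peek e f)  = cost e + (cost f + 1)

setReg-same : ∀ w r v s → regs (setReg w r v s) r ≡ truncate w v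
setReg-same w r v s with r ≡ᵇ r in eq
... | true  = refl
... | false = contradiction (subst T eq (≡⇒≡ᵇ r r refl)) (λ ())

setReg-other : ∀ w {r r′} v s → r′ ≢ r → regs (setReg w r v s) r′ ≡ regs s r′
setReg-other w {r} {r′} v s r′≢r with r′ ≡ᵇ r in eq
... | true  = contradiction (≡ᵇ⇒≡ r′ r (subst T (sym eq) tt)) r′≢r
... | false = refl

_⊨_ : State → Env → Set
s ⊨ ρ = ∀ i → regs s (toℕ i) ≡ lookup ρ i

module _ (w : ℕ) (M : ℕ → Bool) where

  record Computes (p : Program) (t d v : ℕ) (s : State) : Set where
    constructor computed
    field
      final : State
      run   : w ⊢ p , s ⇓[ t ] final
      value : regs final d ≡ v
      frame : ∀ r → r < d → regs final r ≡ regs s r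
      mem≡  : mem final ≡ M

  -- Registers serve as a stack: the second operand is computed in `suc d`, and the frame condition
  -- keeps the first one in `d` and the variables below 3 intact.
  compile-correct : ∀ ρ e d s → 3 ≤ d → s ⊨ ρ → mem s ≡ M →
                    Computes (compile d e) (cost e) d (⟦ e ⟧ w M ρ) s

  private
    combine : ∀ ρ e f d s → 3 ≤ d → s ⊨ ρ → mem s ≡ M →
      (i : Instr) (v : ℕ → ℕ → ℕ) →
      (∀ s → mem s ≡ M →
         exec w i s ≡ setReg w d (v (regs s d) (regs s (suc d))) s) →
      Computes (compile d e ⨾ compile (suc d) f ⨾ instr i)
               (cost e + (cost f + 1)) d
               (truncate w (v (⟦ e ⟧ w M ρ) (⟦ f ⟧ w M ρ))) s
    combine ρ e f d s 3≤d sρ sM i v ok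
      with compile-correct ρ e d s 3≤d sρ sM
    ... | computed s₁ run₁ v₁ fr₁ m₁
      with compile-correct ρ f (suc d) s₁ (m≤n⇒m≤1+n 3≤d)
             (λ j → trans (fr₁ _ (<-≤-trans (toℕ<n j) 3≤d)) (sρ j)) m₁
    ... | computed s₂ run₂ v₂ fr₂ m₂ = computed (exec w i s₂)
      (seq run₁ (seq run₂ instr))
      (trans (cong (λ s → regs s d) (ok s₂ m₂))
        (trans (setReg-same w d _ s₂)
          (cong (truncate w) (cong₂ v (trans (fr₂ d ≤-refl) v₁) v₂))))
      (λ r r<d → trans (cong (λ s → regs s r) (ok s₂ m₂))
        (trans (setReg-other w _ s₂ (<⇒≢ r<d))
          (trans (fr₂ r (m≤n⇒m≤1+n r<d)) (fr₁ r r<d))))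
      (trans (cong mem (ok s₂ m₂)) m₂)

  compile-correct ρ (var i) d s 3≤d sρ sM = computed _ (seq instr instr)
    (trans (setReg-same w d _ s₁)
      (cong (truncate w)
        (cong₂ _+_ (trans (setReg-other w 0 s (<⇒≢ (<-≤-trans (toℕ<n i) 3≤d))) (sρ i))
                   (setReg-same w d 0 s))))
    (λ r r<d → trans (setReg-other w _ s₁ (<⇒≢ r<d)) (setReg-other w 0 s (<⇒≢ r<d)))
    sM
    where s₁ = setReg w d 0 s
  compile-correct ρ (lit k) d s 3≤d sρ sM = computed _ instr
    (setReg-same w d k s) (λ r r<d → setReg-other w k s (<⇒≢ r<d)) sM
  compile-correct ρ word d s 3≤d sρ sM = computed _ instr
    (setReg-same w d w s) (λ r r<d → setReg-other w w s (<⇒≢ r<d)) sM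
  compile-correct ρ (bin o e f) d s 3≤d sρ sM =
    combine ρ e f d s 3≤d sρ sM _ (evalOp w o) (λ _ _ → refl)
  compile-correct ρ (peek e f) d s 3≤d sρ sM =
    combine ρ e f d s 3≤d sρ sM _
      (λ a l → fromBits (l ⊓ w) (λ i → M (a + i))) (λ { _ refl → refl })

-- Assignments and control flow as transitions between environments

infix 4 _≔_

_≔_ : Fin 3 → Exp → Program
i ≔ e = compile 3 e ⨾ instr (literal 4 0) ⨾ instr (op ADD (toℕ i) 3 4)

-- Only the three variables and the memory are observed; quantifying over all states that agree with
-- `ρ` hides the scratch registers from 3 on.
record Runs (w : ℕ) (M : ℕ → Bool) (p : Program) (T : ℕ) (ρ ρ′ : Env) : Set where
  constructor runs
  field
    from : ∀ s → s ⊨ ρ → mem s ≡ M →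
           ∃[ t ] ∃[ s′ ] (t ≤ T × w ⊢ p , s ⇓[ t ] s′ × s′ ⊨ ρ′ × mem s′ ≡ M)

truncate-< : ∀ w {v} → v < 2 ^ w → truncate w v ≡ v
truncate-< w v< = m<n⇒m%n≡m {{m^n≢0 2 w}} v<

module _ {w : ℕ} {M : ℕ → Bool} where

  runs-≔ : ∀ {ρ} i e {v} → ⟦ e ⟧ w M ρ ≡ v → v < 2 ^ w →
           Runs w M (i ≔ e) (cost e + 2) ρ (ρ [ i ]≔ v)
  runs-≔ {ρ} i e {v} e≡v v< = runs from
    where
    from : ∀ s → s ⊨ ρ → mem s ≡ M →
           ∃[ t ] ∃[ s′ ] (t ≤ cost e + 2 × w ⊢ i ≔ e , s ⇓[ t ] s′ × s′ ⊨ (ρ [ i ]≔ v) × mem s′ ≡ M)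
    from s sρ sM with compile-correct w M ρ e 3 s ≤-refl sρ sM
    ... | computed s₁ run₁ v₁ fr₁ m₁ =
      _ , _ , ≤-refl , seq run₁ (seq instr instr) , agree , m₁
      where
      s₂ = setReg w 4 0 s₁
      sum≡ : truncate w (regs s₂ 3 + regs s₂ 4) ≡ v
      sum≡ = trans (cong₂ (λ a b → truncate w (a + b)) (trans v₁ e≡v)
                          (trans (setReg-same w 4 0 s₁) (truncate-< w (m^n>0 2 w))))
               (trans (cong (truncate w) (+-identityʳ v)) (truncate-< w v<))
      agree : setReg w (toℕ i) (regs s₂ 3 + regs s₂ 4) s₂ ⊨ (ρ [ i ]≔ v)
      agree j with j Fin.≟ i
      ... | yes refl = trans (setReg-same w (toℕ i) _ s₂) (trans sum≡ (sym (lookup∘update i ρ v)))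
      ... | no j≢i = trans (setReg-other w _ s₂ (j≢i ∘ toℕ-injective))
          (trans (setReg-other w 0 s₁ (<⇒≢ (<-trans (toℕ<n j) (s≤s ≤-refl))))
            (trans (fr₁ _ (toℕ<n j)) (trans (sρ j) (sym (lookup∘update′ j≢i ρ v)))))

  runs-⨾ : ∀ {p q T U ρ ρ′ ρ″} → Runs w M p T ρ ρ′ → Runs w M q U ρ′ ρ″ →
           Runs w M (p ⨾ q) (T + U) ρ ρ″
  runs-⨾ (runs P) (runs Q) = runs λ s sρ sM →
    let t , s₁ , t≤ , run₁ , sρ₁ , m₁ = P s sρ sM
        u , s₂ , u≤ , run₂ , post     = Q s₁ sρ₁ m₁
    in  _ , s₂ , +-mono-≤ t≤ u≤ , seq run₁ run₂ , post

  runs-ifTrue : ∀ {p q T ρ ρ′} i → lookup ρ i ≢ 0 → Runs w M p T ρ ρ′ →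
                Runs w M (ifnz (toℕ i) p q) (suc T) ρ ρ′
  runs-ifTrue i nz (runs P) = runs λ s sρ sM →
    let t , s₁ , t≤ , run₁ , post = P s sρ sM
    in  _ , s₁ , s≤s t≤ , ifTrue (nz ∘ trans (sym (sρ i))) run₁ , post

  runs-ifFalse : ∀ {p q T ρ ρ′} i → lookup ρ i ≡ 0 → Runs w M q T ρ ρ′ →
                 Runs w M (ifnz (toℕ i) p q) (suc T) ρ ρ′
  runs-ifFalse i z (runs Q) = runs λ s sρ sM →
    let t , s₁ , t≤ , run₁ , post = Q s sρ sM
    in  _ , s₁ , s≤s t≤ , ifFalse (trans (sρ i) z) run₁ , post

  runs-loop : ∀ {p T U ρ ρ′ ρ″} i → lookup ρ i ≢ 0 → Runs w M p T ρ ρ′ →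
              Runs w M (while (toℕ i) p) U ρ′ ρ″ →
              Runs w M (while (toℕ i) p) (suc (T + U)) ρ ρ″
  runs-loop i nz (runs P) (runs Q) = runs λ s sρ sM →
    let t , s₁ , t≤ , run₁ , sρ₁ , m₁ = P s sρ sM
        u , s₂ , u≤ , run₂ , post     = Q s₁ sρ₁ m₁
    in  _ , s₂ , s≤s (+-mono-≤ t≤ u≤) , loop (nz ∘ trans (sym (sρ i))) run₁ run₂ , post

  runs-done : ∀ {p ρ} i → lookup ρ i ≡ 0 → Runs w M (while (toℕ i) p) 1 ρ ρ
  runs-done i z = runs λ s sρ sM → 1 , s , ≤-refl , done (trans (sρ i) z) , sρ , sM

  runs-weaken : ∀ {p T U ρ ρ′} → T ≤ U → Runs w M p T ρ ρ′ → Runs w M p U ρ ρ′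
  runs-weaken T≤U (runs P) = runs λ s sρ sM →
    let t , s₁ , t≤ , post = P s sρ sM in t , s₁ , ≤-trans t≤ T≤U , post

-- Counting and packed bit fields

bit : Bool → ℕ
bit b = if b then 1 else 0

bit≤1 : ∀ b → bit b ≤ 1
bit≤1 true  = ≤-refl
bit≤1 false = z≤n

cnt : (ℕ → Bool) → ℕ → ℕ
cnt f zero    = 0
cnt f (suc l) = bit (f 0) + cnt (f ∘ suc) l

cnt-cong : ∀ {f g} l → (∀ i → i < l → f i ≡ g i) → cnt f l ≡ cnt g l
cnt-cong zero    f≗g = refl
cnt-cong (suc l) f≗g =
  cong₂ (λ b c → bit b + c) (f≗g 0 z<s) (cnt-cong l (λ i i<l → f≗g (suc i) (s<s i<l)))

cnt-+ : ∀ f a c → cnt f (a + c) ≡ cnt f a + cnt (λ i → f (a + i)) c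
cnt-+ f zero    c = refl
cnt-+ f (suc a) c =
  trans (cong (bit (f 0) +_) (cnt-+ (f ∘ suc) a c)) (sym (+-assoc (bit (f 0)) _ _))

cnt-≤ : ∀ f l → cnt f l ≤ l
cnt-≤ f zero    = z≤n
cnt-≤ f (suc l) = +-mono-≤ (bit≤1 (f 0)) (cnt-≤ (f ∘ suc) l)

cnt-mono : ∀ f {a c} → a ≤ c → cnt f a ≤ cnt f c
cnt-mono f {a} {c} a≤c with m≤n⇒∃[o]m+o≡n a≤c
... | o , refl = subst (cnt f a ≤_) (sym (cnt-+ f a o)) (m≤m+n _ _)

cnt-false : ∀ l → cnt (λ _ → false) l ≡ 0
cnt-false zero    = refl
cnt-false (suc l) = cnt-false l

cnt-<ᵇ : ∀ {p n} → p ≤ n → cnt (_<ᵇ p) n ≡ p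
cnt-<ᵇ {n = n} z≤n   = cnt-false n
cnt-<ᵇ (s≤s p≤n)     = cong suc (cnt-<ᵇ p≤n)

bit-odd : ∀ x → bit ((x % 2) ≡ᵇ 1) ≡ x % 2
bit-odd x with x % 2 | m%n<n x 2
... | 0           | _ = refl
... | 1           | _ = refl
... | suc (suc _) | s≤s (s≤s ())

fromBits-testBit : ∀ l {v} → v < 2 ^ l → fromBits l (testBit v) ≡ v
fromBits-testBit zero    {zero} _ = refl
fromBits-testBit zero    {suc v} (s≤s ())
fromBits-testBit (suc l) {v} v< = begin
  bit ((v % 2) ≡ᵇ 1) + 2 * fromBits l (testBit (v / 2))
    ≡⟨ cong₂ (λ a c → a + 2 * c) (bit-odd v)
         (fromBits-testBit l (m<n*o⇒m/o<n (subst (v <_) (*-comm 2 (2 ^ l)) v<))) ⟩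
  v % 2 + 2 * (v / 2) ≡⟨ cong (v % 2 +_) (*-comm 2 (v / 2)) ⟩
  v % 2 + v / 2 * 2   ≡⟨ m≡m%n+[m/n]*n v 2 ⟨
  v ∎
  where open ≡-Reasoning

fromBits-cong : ∀ l {f g} → (∀ i → i < l → f i ≡ g i) → fromBits l f ≡ fromBits l g
fromBits-cong zero    f≗g = refl
fromBits-cong (suc l) f≗g =
  cong₂ (λ b c → bit b + 2 * c) (f≗g 0 z<s) (fromBits-cong l (λ i i<l → f≗g (suc i) (s<s i<l)))

fromBits-< : ∀ l f → fromBits l f < 2 ^ l
fromBits-< zero    f = ≤-refl
fromBits-< (suc l) f = begin
  suc (bit (f 0) + 2 * X) ≤⟨ s≤s (+-monoˡ-≤ (2 * X) (bit≤1 (f 0))) ⟩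
  2 + 2 * X               ≡⟨ *-suc 2 X ⟨
  2 * suc X               ≤⟨ *-monoʳ-≤ 2 (fromBits-< l (f ∘ suc)) ⟩
  2 * 2 ^ l               ∎
  where
  open ≤-Reasoning
  X = fromBits l (f ∘ suc)

testBit-0 : ∀ i → testBit 0 i ≡ false
testBit-0 zero    = refl
testBit-0 (suc i) = testBit-0 i

bit+2*-half : ∀ b x → (bit b + 2 * x) / 2 ≡ x
bit+2*-half b x = begin
  (bit b + 2 * x) / 2     ≡⟨ +-distrib-/-∣ʳ (bit b) (m∣m*n x) ⟩
  bit b / 2 + 2 * x / 2   ≡⟨ cong₂ _+_ (half b) (trans (cong (_/ 2) (*-comm 2 x)) (m*n/n≡m x 2)) ⟩
  x ∎
  where
  open ≡-Reasoning
  half : ∀ b → bit b / 2 ≡ 0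
  half true  = refl
  half false = refl

bit+2*-odd : ∀ b x → ((bit b + 2 * x) % 2 ≡ᵇ 1) ≡ b
bit+2*-odd b x = trans
  (cong (_≡ᵇ 1) (trans (cong (λ y → (bit b + y) % 2) (*-comm 2 x)) ([m+kn]%n≡m%n (bit b) x 2)))
  (odd b)
  where
  odd : ∀ b → (bit b % 2 ≡ᵇ 1) ≡ b
  odd true  = refl
  odd false = refl

testBit-fromBits-< : ∀ l f i → i < l → testBit (fromBits l f) i ≡ f i
testBit-fromBits-< (suc l) f zero    _         =
  bit+2*-odd (f 0) (fromBits l (f ∘ suc))
testBit-fromBits-< (suc l) f (suc i) (s≤s i<l) =
  trans (cong (λ x → testBit x i) (bit+2*-half (f 0) (fromBits l (f ∘ suc))))
        (testBit-fromBits-< l (f ∘ suc) i i<l)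

testBit-fromBits-≥ : ∀ l f i → testBit (fromBits l f) (l + i) ≡ false
testBit-fromBits-≥ zero    f i = testBit-0 i
testBit-fromBits-≥ (suc l) f i =
  trans (cong (λ x → testBit x (l + i)) (bit+2*-half (f 0) (fromBits l (f ∘ suc))))
        (testBit-fromBits-≥ l (f ∘ suc) i)

-- A short chunk, read as a number, is padded with zeros, so one table over `b` bits serves chunks
-- of every length `j ≤ b`.
popcount : ∀ f {j b} → j ≤ b → cnt (testBit (fromBits j f)) b ≡ cnt f j
popcount f {j} j≤b with m≤n⇒∃[o]m+o≡n j≤b
... | o , refl = begin
  cnt (testBit X) (j + o)
    ≡⟨ cnt-+ (testBit X) j o ⟩
  cnt (testBit X) j + cnt (λ i → testBit X (j + i)) o
    ≡⟨ cong₂ _+_ (cnt-cong j (testBit-fromBits-< j f))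
                 (trans (cnt-cong o (λ i _ → testBit-fromBits-≥ j f i)) (cnt-false o)) ⟩
  cnt f j + 0
    ≡⟨ +-identityʳ _ ⟩
  cnt f j ∎
  where
  open ≡-Reasoning
  X = fromBits j f

bits : ℕ → ℕ → List Bool
bits zero    v = []
bits (suc l) v = testBit v 0 ∷ bits l (v / 2)

array : (width count : ℕ) → (ℕ → ℕ) → List Bool
array l zero    f = []
array l (suc c) f = bits l (f 0) ++ array l c (f ∘ suc)

length-bits : ∀ l v → length (bits l v) ≡ l
length-bits zero    v = refl
length-bits (suc l) v = cong suc (length-bits l (v / 2))

length-array : ∀ l c f → length (array l c f) ≡ c * l
length-array l zero    f = refl
length-array l (suc c) f =
  trans (length-++ (bits l (f 0))) (cong₂ _+_ (length-bits l (f 0)) (length-array l c (f ∘ suc)))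

-- `Holds` fixes the start address 0; with the address as a parameter, a concatenation splits into
-- its sections by recursion.
Stored : (ℕ → Bool) → ℕ → List Bool → Set
Stored M a []       = ⊤
Stored M a (x ∷ xs) = M a ≡ x × Stored M (suc a) xs

Holds⇒Stored : ∀ {M} bs → Holds M bs → Stored M 0 bs
Holds⇒Stored {M} bs h = go 0 bs h
  where
  go : ∀ a bs → (∀ (i : Fin (length bs)) → M (a + toℕ i) ≡ List.lookup bs i) → Stored M a bs
  go a []       h = tt
  go a (x ∷ bs) h = trans (cong M (sym (+-identityʳ a))) (h Fin.zero)
    , go (suc a) bs (λ i → trans (cong M (sym (+-suc a (toℕ i)))) (h (Fin.suc i)))

Stored-++ : ∀ {M} a xs {ys} → Stored M a (xs ++ ys) →
            Stored M a xs × Stored M (a + length xs) ys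
Stored-++ {M} a []       {ys} s = tt , subst (λ a → Stored M a ys) (sym (+-identityʳ a)) s
Stored-++ {M} a (x ∷ xs) {ys} (e , s) with Stored-++ (suc a) xs s
... | s₁ , s₂ = (e , s₁) , subst (λ a → Stored M a ys) (sym (+-suc a (length xs))) s₂

Stored-bits : ∀ {M} a l v → Stored M a (bits l v) → ∀ i → i < l → M (a + i) ≡ testBit v i
Stored-bits {M} a (suc l) v (e , s) zero    _ = trans (cong M (+-identityʳ a)) e
Stored-bits {M} a (suc l) v (e , s) (suc i) (s≤s i<l) =
  trans (cong M (+-suc a i)) (Stored-bits (suc a) l (v / 2) s i i<l)

-- Entry `i` comes after `i` entries of `l` bits each, and `bits` loses nothing of a value below
-- `2 ^ l`.
Stored-array : ∀ {M} a l c f → Stored M a (array l c f) → ∀ {i} → i < c → f i < 2 ^ l →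
               fromBits l (λ k → M (a + i * l + k)) ≡ f i
Stored-array {M} a l (suc c) f s {zero} _ v< =
  trans (fromBits-cong l λ k k<l →
          trans (cong (λ a → M (a + k)) (+-identityʳ a))
                (Stored-bits a l (f 0) (proj₁ (Stored-++ a (bits l (f 0)) s)) k k<l))
        (fromBits-testBit l v<)
Stored-array {M} a l (suc c) f s {suc i} (s≤s i<c) v< =
  trans (fromBits-cong l λ k _ → cong (λ a → M (a + k)) (sym (+-assoc a l (i * l))))
        (Stored-array (a + l) l c (f ∘ suc) rest i<c v<)
  where
  rest = subst (λ x → Stored M (a + x) (array l c (f ∘ suc))) (length-bits l (f 0))
               (proj₂ (Stored-++ a (bits l (f 0)) s))

-- Rank and select in terms of prefix counts

member : ∀ {n} → Subset n → ℕ → Bool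
member []      _       = false
member (x ∷ S) zero    = x
member (x ∷ S) (suc i) = member S i

Stored-member : ∀ {M n} a (S : Subset n) → Stored M a (Vec.toList S) →
                ∀ i → i < n → M (a + i) ≡ member S i
Stored-member {M} a (x ∷ S) (e , s) zero    _ = trans (cong M (+-identityʳ a)) e
Stored-member {M} a (x ∷ S) (e , s) (suc i) (s≤s i<n) =
  trans (cong M (+-suc a i)) (Stored-member (suc a) S s i i<n)

count-none : ∀ {A : Set} {P : A → Set} (P? : ∀ x → Dec (P x)) →
             (∀ x → does (P? x) ≡ false) → ∀ {m} (xs : Vec A m) → Vec.count P? xs ≡ 0
count-none P? none []       = refl
count-none P? none (x ∷ xs) rewrite none x = count-none P? none xs

count-map : ∀ {A B : Set} {P : A → Set} {Q : B → Set}
            (P? : ∀ x → Dec (P x)) (Q? : ∀ x → Dec (Q x)) (f : A → B) →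
            (∀ x → does (Q? (f x)) ≡ does (P? x)) →
            ∀ {m} (xs : Vec A m) → Vec.count Q? (Vec.map f xs) ≡ Vec.count P? xs
count-map P? Q? f eq []       = refl
count-map P? Q? f eq (x ∷ xs) rewrite eq x with does (P? x)
... | true  = cong suc (count-map P? Q? f eq xs)
... | false = count-map P? Q? f eq xs

<⇒<ᵇ≡ : ∀ {m n} → m < n → (m <ᵇ n) ≡ true
<⇒<ᵇ≡ {m} {n} m<n with m <ᵇ n in eq
... | true  = refl
... | false = contradiction (subst T eq (<⇒<ᵇ m<n)) (λ ())

≥⇒<ᵇ≡ : ∀ {m n} → n ≤ m → (m <ᵇ n) ≡ false
≥⇒<ᵇ≡ {m} {n} n≤m with m <ᵇ n in eq
... | false = refl
... | true  = contradiction (<ᵇ⇒< m n (subst T (sym eq) tt)) (≤⇒≯ n≤m)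

suc-≤ᵇ : ∀ {n} (x y : Fin n) → (toℕ (Fin.suc y) ≤ᵇ toℕ (Fin.suc x)) ≡ (toℕ y ≤ᵇ toℕ x)
suc-≤ᵇ x Fin.zero    = refl
suc-≤ᵇ x (Fin.suc y) = refl

rank≡cnt : ∀ {n} (x : Fin n) (S : Subset n) → rank x S ≡ cnt (member S) (suc (toℕ x))
rank≡cnt {suc n} Fin.zero (inside ∷ S) =
  -- Every later element is a successor, hence not `≤ 0`: the test becomes the decision of the empty
  -- predicate.
  cong suc (trans (count-map {P = λ _ → ⊥} (λ _ → no id) (Fin._≤? Fin.zero {n}) Fin.suc
                             (λ _ → refl) (elements S))
                  (count-none _ (λ _ → refl) (elements S)))
rank≡cnt {suc n} Fin.zero (outside ∷ S) =
  trans (count-map {P = λ _ → ⊥} (λ _ → no id) (Fin._≤? Fin.zero {n}) Fin.suc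
                   (λ _ → refl) (elements S))
        (count-none _ (λ _ → refl) (elements S))
rank≡cnt {suc n} (Fin.suc x) (inside ∷ S) =
  cong suc (trans (count-map (Fin._≤? x) (Fin._≤? Fin.suc x) Fin.suc (suc-≤ᵇ {n} x) (elements S))
                  (rank≡cnt x S))
rank≡cnt {suc n} (Fin.suc x) (outside ∷ S) =
  trans (count-map (Fin._≤? x) (Fin._≤? Fin.suc x) Fin.suc (suc-≤ᵇ {n} x) (elements S)) (rank≡cnt x S)

cnt-select : ∀ {n} (S : Subset n) i → cnt (member S) (toℕ (select S i)) ≡ toℕ i
cnt-select (inside ∷ S) Fin.zero = refl
cnt-select (inside ∷ S) (Fin.suc i)
  rewrite lookup-map i Fin.suc (elements S) = cong suc (cnt-select S i)
cnt-select (outside ∷ S) i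
  rewrite lookup-map i Fin.suc (elements S) = cnt-select S i

cnt-suc-select : ∀ {n} (S : Subset n) i → cnt (member S) (suc (toℕ (select S i))) ≡ suc (toℕ i)
cnt-suc-select (inside ∷ S) Fin.zero = refl
cnt-suc-select (inside ∷ S) (Fin.suc i)
  rewrite lookup-map i Fin.suc (elements S) = cong suc (cnt-suc-select S i)
cnt-suc-select (outside ∷ S) i
  rewrite lookup-map i Fin.suc (elements S) = cnt-suc-select S i

-- The prefix count is monotone and rises from `toℕ i` to `suc (toℕ i)` exactly at the selected
-- element, so comparing counts amounts to comparing positions. Both the table of positions and the
-- binary search rest on this.
select-<ᵇ : ∀ {n} (S : Subset n) i y →
            (cnt (member S) y <ᵇ suc (toℕ i)) ≡ (y <ᵇ suc (toℕ (select S i)))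
select-<ᵇ S i y with y ≤? toℕ (select S i)
... | yes y≤p = trans
  (<⇒<ᵇ≡ (s≤s (≤-trans (cnt-mono (member S) y≤p) (≤-reflexive (cnt-select S i)))))
  (sym (<⇒<ᵇ≡ (s≤s y≤p)))
... | no y≰p = trans
  (≥⇒<ᵇ≡ (≤-trans (≤-reflexive (sym (cnt-suc-select S i))) (cnt-mono (member S) (≰⇒> y≰p))))
  (sym (≥⇒<ᵇ≡ (≰⇒> y≰p)))

-- Degree-d values: with words of 64 * L bits, every value of degree at most 64
-- fits, so bounding the intermediate results reduces to counting degrees.
record Small (L d v : ℕ) : Set where
  constructor bounded
  field
    bound : v < 2 ^ (d * L)

open Small

n<2^n : ∀ n → n < 2 ^ n
n<2^n zero    = ≤-refl
n<2^n (suc n) = begin-strict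
  suc n         ≤⟨ n<2^n n ⟩
  2 ^ n         <⟨ m<m+n (2 ^ n) (m^n>0 2 n) ⟩
  2 ^ n + 2 ^ n ≡⟨ cong (2 ^ n +_) (+-identityʳ (2 ^ n)) ⟨
  2 * 2 ^ n     ∎
  where open ≤-Reasoning

module _ {L : ℕ} where

  small-≤ : ∀ {d u v} → u ≤ v → Small L d v → Small L d u
  small-≤ u≤v (bounded v<) = bounded (≤-<-trans u≤v v<)

  -- Between numerals the inequality is decided by evaluation and the `True` argument is filled in
  -- silently, which leaves the counting of degrees to the type checker.
  small-weaken : ∀ {d v} e → {True (d ≤? e)} → Small L d v → Small L e v
  small-weaken e {d≤e} (bounded v<) = bounded (<-≤-trans v< (^-monoʳ-≤ 2 (*-monoˡ-≤ L (toWitness d≤e))))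

  small-* : ∀ {d e u v} → Small L d u → Small L e v → Small L (d + e) (u * v)
  small-* {d} {e} (bounded u<) (bounded v<) = bounded (<-≤-trans (*-mono-< u< v<) (≤-reflexive (sym
    (trans (cong (2 ^_) (*-distribʳ-+ L d e)) (^-distribˡ-+-* 2 (d * L) (e * L))))))

  -- Degree 2 rather than 1, as the bound is strict and `d = L` is allowed.
  small-2^ : ∀ {d} → d ≤ L → .{{NonZero L}} → Small L 2 (2 ^ d)
  small-2^ {d} d≤L = bounded (^-monoʳ-< 2 ≤-refl
    (<-≤-trans (s≤s d≤L) (subst (suc L ≤_) (cong (L +_) (sym (+-identityʳ L))) (m<n+m L (>-nonZero⁻¹ L)))))

  module _ .{{_ : NonZero L}} where

    -- One more bit suffices for a sum, and one more degree provides `L ≥ 1` bits.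
    small-+ : ∀ {d e u v} → Small L d u → Small L e v → Small L (suc (d ⊔ e)) (u + v)
    small-+ {d} {e} {u} {v} u< v< = bounded (begin-strict
      u + v               <⟨ +-mono-< (up (m≤m⊔n d e) u<) (up (m≤n⊔m d e) v<) ⟩
      X + X               ≡⟨ cong (X +_) (+-identityʳ X) ⟨
      2 ^ suc ((d ⊔ e) * L) ≤⟨ ^-monoʳ-≤ 2 (+-monoˡ-≤ ((d ⊔ e) * L) (>-nonZero⁻¹ L)) ⟩
      2 ^ (L + (d ⊔ e) * L) ∎)
      where
      open ≤-Reasoning
      X = 2 ^ ((d ⊔ e) * L)
      up : ∀ {c u} → c ≤ d ⊔ e → Small L c u → u < X
      up c≤ (bounded u<) = <-≤-trans u< (^-monoʳ-≤ 2 (*-monoˡ-≤ L c≤))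

    small-const : ∀ d {k} → {True (k <? 2 ^ d)} → Small L d k
    small-const d {_} {k<} = bounded (<-≤-trans (toWitness k<) (^-monoʳ-≤ 2 (m≤m*n d L)))

    small-bit : ∀ b → Small L 1 (bit b)
    small-bit b = small-≤ (bit≤1 b) (small-const 1)

    small-L : Small L 1 L
    small-L = bounded (subst (λ x → L < 2 ^ x) (sym (*-identityˡ L)) (n<2^n L))

-- Evaluation of expressions without overflow

infixl 6 _⊕_
infixl 7 _⊗_ _⊘_ _⊙_

_⊕_ _⊗_ _⊘_ _⊙_ _≺_ : Exp → Exp → Exp
_⊕_ = bin ADD
_⊗_ = bin MUL
_⊘_ = bin DIV
_⊙_ = bin MOD
_≺_ = bin LT

module Values {w L : ℕ} .{{_ : NonZero L}} (w≡64L : w ≡ 64 * L) (M : ℕ → Bool) (ρ : Env) where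

  small⇒word : ∀ {d v} {d≤ : True (d ≤? 64)} → Small L d v → v < 2 ^ w
  small⇒word {d≤ = d≤} (bounded v<) =
    <-≤-trans v< (^-monoʳ-≤ 2 (≤-trans (*-monoˡ-≤ L (toWitness d≤)) (≤-reflexive (sym w≡64L))))

  -- `v` is meant to be the exact value in ℕ; the degree is what shows that the enclosing operation
  -- does not overflow.
  record Val (e : Exp) (v d : ℕ) : Set where
    constructor _,_
    field
      value : ⟦ e ⟧ w M ρ ≡ v
      small : Small L d v
  open Val public

  val-var : ∀ d {v} {d≤ : True (d ≤? 64)} i → lookup ρ i ≡ v → Small L d v → Val (var i) v d
  val-var d {d≤ = d≤} i refl v< =
    trans (cong (λ x → truncate w (lookup ρ i + x)) (truncate-< w (m^n>0 2 w)))
      (trans (cong (truncate w) (+-identityʳ _)) (truncate-< w (small⇒word {d≤ = d≤} v<))) , v<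

  val-lit : ∀ d {k} {k< : True (k <? 2 ^ d)} {d≤ : True (d ≤? 64)} → Val (lit k) k d
  val-lit d {k} {k<} {d≤} =
    truncate-< w (small⇒word {d≤ = d≤} (small-const d {_} {k<})) , small-const d {_} {k<}

  private
    val-bin : ∀ o {e f x y d c} v → {True (c ≤? 64)} → Val e x d → ⟦ f ⟧ w M ρ ≡ y →
              evalOp w o x y ≡ v → Small L c v → Val (bin o e f) v c
    val-bin o {c = c} v {c≤} E F≡ ev v< =
      trans (cong (truncate w) (trans (cong₂ (evalOp w o) (value E) F≡) ev))
            (truncate-< w (small⇒word {d≤ = c≤} v<)) , v<

  val-+ : ∀ {e f x y d c} {fit : True (suc (d ⊔ c) ≤? 64)} →
          Val e x d → Val f y c → Val (e ⊕ f) (x + y) (suc (d ⊔ c))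
  val-+ {d = d} {c} {fit} E F =
    val-bin ADD _ {fit} E (value F) refl (small-+ (small E) (small F))

  val-* : ∀ {e f x y d c} {fit : True (d + c ≤? 64)} →
          Val e x d → Val f y c → Val (e ⊗ f) (x * y) (d + c)
  val-* {d = d} {c} {fit} E F =
    val-bin MUL _ {fit} E (value F) refl (small-* (small E) (small F))

  val-/ : ∀ {e f x y d c} .{{_ : NonZero y}} {fit : True (d ≤? 64)} →
          Val e x d → Val f y c → Val (e ⊘ f) (x / y) d
  val-/ {x = x} {suc y} {d = d} {fit = fit} E F =
    val-bin DIV _ {fit} E (value F) refl (small-≤ (m/n≤m x (suc y)) (small E))

  val-% : ∀ {e f x y d c} .{{_ : NonZero y}} {fit : True (d ≤? 64)} →
          Val e x d → Val f y c → Val (e ⊙ f) (x % y) d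
  val-% {x = x} {suc y} {d = d} {fit = fit} E F =
    val-bin MOD _ {fit} E (value F) refl (small-≤ (m%n≤m x (suc y)) (small E))

  val-< : ∀ {e f x y d c} → Val e x d → Val f y c → Val (e ≺ f) (bit (x <ᵇ y)) 1
  val-< {x = x} {y} E F = val-bin LT _ E (value F) refl (small-bit (x <ᵇ y))

  val-peek : ∀ c {e f x l v d d′} {fit : True (c ≤? 64)} → Val e x d → Val f l d′ → l ≤ w →
             fromBits l (λ i → M (x + i)) ≡ v → Small L c v → Val (peek e f) v c
  val-peek c {fit = fit} E F l≤w v≡ v< = trans
    (cong (truncate w)
      (trans (cong₂ (λ x l → fromBits (l ⊓ w) (λ i → M (x + i))) (value E) (value F))
        (trans (cong (λ l → fromBits l _) (m≤n⇒m⊓n≡m l≤w)) v≡)))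
    (truncate-< w (small⇒word {d≤ = fit} v<)) , v<

  -- The word size is known before any memory is read, so `L` is taken from it; 64 is the
  -- `wordFactor` of `darray`.
  length-exp : Exp
  length-exp = word ⊘ lit 64

  val-length : Val length-exp L 1
  val-length = trans
    (cong (truncate w) (cong₂ (evalOp w DIV) (truncate-< w (n<2^n w)) (value (val-lit 7))))
    (trans (cong (truncate w) (trans (cong (_/ 64) (trans w≡64L (*-comm 64 L))) (m*n/n≡m L 64)))
      (truncate-< w (small⇒word small-L))) , small-L

-- The query programs

runs⇒answers : ∀ {w p bs q a T} → q < 2 ^ w →
  (∀ M → Stored M 0 bs → ∃[ ρ ] Runs w M p T (q ∷ 0 ∷ 0 ∷ []) (a ∷ ρ)) → Answers w p bs q a T
runs⇒answers {w} {bs = bs} {q} q< run M holds with run M (Holds⇒Stored bs holds)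
... | ρ , runs r with r (initial w q M) start refl
  where
  start : initial w q M ⊨ (q ∷ 0 ∷ 0 ∷ [])
  start Fin.zero                     = truncate-< w q<
  start (Fin.suc Fin.zero)           = refl
  start (Fin.suc (Fin.suc Fin.zero)) = refl
... | t , s , t≤ , run′ , agree , m =
  t , s , t≤ , run′ , agree Fin.zero , subst (λ M → Holds M bs) (sym m) holds

n<2^suc⌊log₂n⌋ : ∀ n → n < 2 ^ suc ⌊log₂ n ⌋
n<2^suc⌊log₂n⌋ n = ≰⇒> λ le →
  1+n≰n (subst (_≤ ⌊log₂ n ⌋) (⌊log₂[2^n]⌋≡n (suc ⌊log₂ n ⌋)) (⌊log₂⌋-mono-≤ le))

⌊log₂n⌋<n : ∀ n .{{_ : NonZero n}} → ⌊log₂ n ⌋ < n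
⌊log₂n⌋<n (suc n) = s≤s (subst (⌊log₂ suc n ⌋ ≤_) (⌊log₂[2^n]⌋≡n n) (⌊log₂⌋-mono-≤ (n<2^n n)))

-- The successor keeps the divisor positive and makes `2 ^ blockSize L` exceed the number of
-- elements in the sparse case.
blockSize : ℕ → ℕ
blockSize L = suc (L / 2)

-- An offset is at most `L * L`, the largest conceivable size of a superblock, and `L * L` is below
-- 2 to this power.
offsetWidth : ℕ → ℕ
offsetWidth L = 2 * suc ⌊log₂ L ⌋

-- Fields are `16 * L` bits wide because addresses into the encoding have degree 16; the numbering
-- is that of `header`.
field-exp : ℕ → Exp
field-exp i = peek (lit i ⊗ (lit 16 ⊗ L)) (lit 16 ⊗ L)
  where L = word ⊘ lit 64

-- The number of elements strictly below `y`: superblock count, plus offset of the block, plus a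
-- table lookup for the bits that precede `y` in its block.
rank-exp : Exp → Exp
rank-exp y =
  peek (field-exp 2 ⊕ q ⊘ L ⊗ L) L ⊕
  (peek (field-exp 3 ⊕ q ⊗ field-exp 1) (field-exp 1) ⊕
   peek (field-exp 5 ⊕ peek (field-exp 4 ⊕ q ⊗ field-exp 0) (y ⊙ field-exp 0) ⊗ L) L)
  where
  L = word ⊘ lit 64
  q = y ⊘ field-exp 0

pattern 0F = Fin.zero
pattern 1F = Fin.suc 0F
pattern 2F = Fin.suc 1F

rankProgram : Program
-- `rank` includes its argument, whereas `rank-exp` counts strictly below.
rankProgram = 0F ≔ rank-exp (var 0F ⊕ lit 1)

-- The argument of rank is reduced modulo n + 1 so that it stays within the
-- stored bits even when the first factor rejects it.
advance-exp : Exp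
advance-exp = var 1F ⊕ var 2F ⊗
  ((z ≺ field-exp 7) ⊗ (rank-exp (z ⊙ field-exp 7) ≺ var 0F))
  where z = var 1F ⊕ var 2F

-- Variable 0 keeps the index sought, variable 1 the lower end of the search window, variable 2 half
-- the length of the window, a power of two.
searchBody : Program
searchBody = (1F ≔ advance-exp) ⨾ (2F ≔ (var 2F ⊘ lit 2))

searchProgram : Program
searchProgram = (2F ≔ field-exp 8) ⨾ while 2 searchBody ⨾ (0F ≔ var 1F)

table-exp : Exp
table-exp = peek (field-exp 6 ⊕ var 0F ⊗ L) L
  where L = word ⊘ lit 64

selectProgram : Program
selectProgram = (2F ≔ field-exp 9) ⨾ ifnz 2 searchProgram (0F ≔ table-exp)

bodyCost : ℕ
bodyCost = (cost advance-exp + 2) + (cost (var 2F ⊘ lit 2) + 2)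

-- The encoding

module Layout (L : ℕ) .{{_ : NonZero L}} {n} (S : Subset n) where

  b k g : ℕ
  b = blockSize L
  k = offsetWidth L
  g = ⌊log₂ ∣ S ∣ ⌋

  c : ℕ → ℕ
  c = cnt (member S)

  superblock offset : ℕ → ℕ
  superblock i = c (i * L * b)
  offset q     = cnt (λ i → member S (q / L * L * b + i)) (q % L * b)

  -- The q-th smallest element, counting from 1.
  position : ℕ → ℕ
  position q = cnt (λ y → c (suc y) <ᵇ q) n

  dense : Bool
  dense = L ≤ᵇ g * g

  -- Block numbers of prefix lengths run from 0 to `n / b` inclusive, since the length may be `n`
  -- itself. The index into `positions` counts from 1, so its entry 0 is a dummy.
  superblocks offsets popcounts positions : List Bool
  superblocks = array L (suc (n / b / L)) superblock
  offsets     = array k (suc (n / b)) offset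
  popcounts   = array L (2 ^ b) (λ x → cnt (testBit x) b)
  positions   = if dense then [] else array L (suc ∣ S ∣) position

  a₁ a₂ a₃ a₄ a₅ : ℕ
  a₁ = 10 * (16 * L)
  a₂ = a₁ + length superblocks
  a₃ = a₂ + length offsets
  a₄ = a₃ + length (Vec.toList S)
  a₅ = a₄ + length popcounts

  header : ℕ → ℕ
  header 0 = b
  header 1 = k
  header 2 = a₁
  header 3 = a₂
  header 4 = a₃
  header 5 = a₄
  header 6 = a₅
  header 7 = suc n
  -- The first search step is half of `2 ^ L`, where `n < 2 ^ L`, so the initial window covers all
  -- positions.
  header 8 = 2 ^ pred L
  header _ = bit dense

  layout : List Bool
  layout = array (16 * L) 10 header ++
           superblocks ++ offsets ++ Vec.toList S ++ popcounts ++ positions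

  length-layout : length layout ≡ a₅ + length positions
  length-layout = begin
    length layout
      ≡⟨ length-++ (array (16 * L) 10 header) ⟩
    length (array (16 * L) 10 header) +
      length (superblocks ++ offsets ++ Vec.toList S ++ popcounts ++ positions)
      ≡⟨ cong₂ _+_ (length-array (16 * L) 10 header) (length-++ superblocks) ⟩
    a₁ + (length superblocks + length (offsets ++ Vec.toList S ++ popcounts ++ positions))
      ≡⟨ +-assoc a₁ _ _ ⟨
    a₂ + length (offsets ++ Vec.toList S ++ popcounts ++ positions)
      ≡⟨ cong (a₂ +_) (length-++ offsets) ⟩
    a₂ + (length offsets + length (Vec.toList S ++ popcounts ++ positions))
      ≡⟨ +-assoc a₂ _ _ ⟨
    a₃ + length (Vec.toList S ++ popcounts ++ positions)
      ≡⟨ cong (a₃ +_) (length-++ (Vec.toList S)) ⟩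
    a₃ + (length (Vec.toList S) + length (popcounts ++ positions))
      ≡⟨ +-assoc a₃ _ _ ⟨
    a₄ + length (popcounts ++ positions)
      ≡⟨ cong (a₄ +_) (length-++ popcounts) ⟩
    a₄ + (length popcounts + length positions)
      ≡⟨ +-assoc a₄ _ _ ⟨
    a₅ + length positions ∎
    where open ≡-Reasoning

  b≤L : b ≤ L
  b≤L = m/n<m L 2 ≤-refl

  k≤2L : k ≤ 2 * L
  k≤2L = *-monoʳ-≤ 2 (⌊log₂n⌋<n L)

  L*L<2^k : L * L < 2 ^ k
  L*L<2^k = <-≤-trans (*-mono-< (n<2^suc⌊log₂n⌋ L) (n<2^suc⌊log₂n⌋ L)) (≤-reflexive
    (trans (sym (^-distribˡ-+-* 2 u u)) (cong (λ v → 2 ^ (u + v)) (sym (+-identityʳ u)))))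
    where u = suc ⌊log₂ L ⌋

  offset< : ∀ q → offset q < 2 ^ k
  offset< q = begin-strict
    offset q  ≤⟨ cnt-≤ _ (q % L * b) ⟩
    q % L * b ≤⟨ *-monoʳ-≤ (q % L) b≤L ⟩
    q % L * L <⟨ *-monoˡ-< L (m%n<n q L) ⟩
    L * L     <⟨ L*L<2^k ⟩
    2 ^ k     ∎
    where open ≤-Reasoning

  -- Division with remainder twice, by `b` into blocks and by `L` into superblocks, with `cnt-+` at
  -- each cut.
  cnt-split : ∀ y → c y ≡ superblock (y / b / L) +
                (offset (y / b) + cnt (λ i → member S (y / b * b + i)) (y % b))
  cnt-split y = begin
    c y
      ≡⟨ cong c (trans (m≡m%n+[m/n]*n y b) (+-comm (y % b) (q * b))) ⟩
    c (q * b + y % b)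
      ≡⟨ cnt-+ (member S) (q * b) (y % b) ⟩
    c (q * b) + r
      ≡⟨ cong (λ x → c (x * b) + r) (trans (m≡m%n+[m/n]*n q L) (+-comm (q % L) (q / L * L))) ⟩
    c ((q / L * L + q % L) * b) + r
      ≡⟨ cong (λ x → c x + r) (*-distribʳ-+ b (q / L * L) (q % L)) ⟩
    c (q / L * L * b + q % L * b) + r
      ≡⟨ cong (_+ r) (cnt-+ (member S) (q / L * L * b) (q % L * b)) ⟩
    superblock (q / L) + offset q + r
      ≡⟨ +-assoc (superblock (q / L)) _ r ⟩
    superblock (q / L) + (offset q + r) ∎
    where
    open ≡-Reasoning
    q = y / b
    r = cnt (λ i → member S (q * b + i)) (y % b)

  -- By `select-<ᵇ` the counted condition says that `y` lies below the selected element.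
  position-select : ∀ i → position (suc (toℕ i)) ≡ toℕ (select S i)
  position-select i =
    trans (cnt-cong n (λ y _ → select-<ᵇ S i (suc y))) (cnt-<ᵇ (<⇒≤ (toℕ<n (select S i))))

-- Correctness of the queries

module Correctness (L : ℕ) .{{_ : NonZero L}} {n} (S : Subset n) (n<2^L : n < 2 ^ L)
                   (fits : Small L 16 (length (Layout.layout L S)))
                   {w} (w≡64L : w ≡ 64 * L) (M : ℕ → Bool)
                   (stored : Stored M 0 (Layout.layout L S)) where

  open Layout L S

  dropSection : ∀ a xs {ys} → Stored M a (xs ++ ys) → Stored M (a + length xs) ys
  dropSection a xs s = proj₂ (Stored-++ a xs s)

  headerStored : Stored M 0 (array (16 * L) 10 header)
  headerStored = proj₁ (Stored-++ 0 (array (16 * L) 10 header) stored)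

  from₁ : Stored M a₁ (superblocks ++ offsets ++ Vec.toList S ++ popcounts ++ positions)
  from₁ = subst (λ a → Stored M a (superblocks ++ offsets ++ Vec.toList S ++ popcounts ++ positions))
            (length-array (16 * L) 10 header)
            (dropSection 0 (array (16 * L) 10 header) stored)

  from₂ : Stored M a₂ (offsets ++ Vec.toList S ++ popcounts ++ positions)
  from₂ = dropSection a₁ superblocks from₁

  from₃ : Stored M a₃ (Vec.toList S ++ popcounts ++ positions)
  from₃ = dropSection a₂ offsets from₂

  from₄ : Stored M a₄ (popcounts ++ positions)
  from₄ = dropSection a₃ (Vec.toList S) from₃

  from₅ : Stored M a₅ positions
  from₅ = dropSection a₄ popcounts from₄

  small-≤n : ∀ {v} → v ≤ n → Small L 1 v
  small-≤n v≤n = bounded (≤-<-trans v≤n (subst (λ x → n < 2 ^ x) (sym (*-identityˡ L)) n<2^L))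

  small-cnt : ∀ f {l} → l ≤ n → Small L 1 (cnt f l)
  small-cnt f l≤n = small-≤n (≤-trans (cnt-≤ f _) l≤n)

  a₅-small : Small L 16 a₅
  a₅-small = small-≤ (≤-trans (m≤m+n a₅ _) (≤-reflexive (sym length-layout))) fits

  a₄-small : Small L 16 a₄
  a₄-small = small-≤ (m≤m+n a₄ _) a₅-small

  a₃-small : Small L 16 a₃
  a₃-small = small-≤ (m≤m+n a₃ _) a₄-small

  a₂-small : Small L 16 a₂
  a₂-small = small-≤ (m≤m+n a₂ _) a₃-small

  a₁-small : Small L 16 a₁
  a₁-small = small-≤ (m≤m+n a₁ _) a₂-small

  b-small : Small L 1 b
  b-small = small-≤ b≤L small-L

  k-small : Small L 3 k
  k-small = small-≤ k≤2L (small-* (small-const 2 {2}) small-L)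

  suc-n-small : Small L 2 (suc n)
  suc-n-small = small-+ {d = 1} (small-const 1) (small-≤n ≤-refl)

  cL≤w : ∀ c → {True (c ≤? 64)} → c * L ≤ w
  cL≤w c {c≤} = ≤-trans (*-monoˡ-≤ L (toWitness c≤)) (≤-reflexive (sym w≡64L))

  L≤w : L ≤ w
  L≤w = subst (_≤ w) (*-identityˡ L) (cL≤w 1)

  <2^L : ∀ {v} → Small L 1 v → v < 2 ^ L
  <2^L {v} = subst (λ x → v < 2 ^ x) (*-identityˡ L) ∘ bound

  module _ {ρ : Env} where

    open Values {w} {L} w≡64L M ρ

    val-field : ∀ i d {i< : True (i <? 10)} {i<′ : True (i <? 2 ^ 4)} {d≤ : True (d ≤? 16)} →
                {d≤′ : True (d ≤? 64)} → Small L d (header i) → Val (field-exp i) (header i) d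
    val-field i d {i<} {i<′} {d≤} {d≤′} v< =
      val-peek d {fit = d≤′}
        (val-* {d = 4} (val-lit 4 {k< = i<′}) (val-* {d = 5} (val-lit 5) val-length))
        (val-* {d = 5} (val-lit 5) val-length) (cL≤w 16)
        (Stored-array 0 (16 * L) 10 header headerStored (toWitness i<) (bound (small-weaken 16 {d≤} v<))) v<

    -- Whatever the degree of `e`, `y ≤ n` resets it to 1; likewise the sum has degree 5 by
    -- construction, and `c y ≤ n` brings it back to 1.
    val-rank : ∀ {e y d} → y ≤ n → Val e y d → Val (rank-exp e) (c y) 1
    val-rank {e} {y} y≤n (e≡ , _) =
      trans (value sum) (sym (cnt-split y)) , small-cnt (member S) y≤n
      where
      q = y / b
      y-val : Val e y 1
      y-val = e≡ , small-≤n y≤n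
      b-val : Val (field-exp 0) b 1
      b-val = val-field 0 1 b-small
      k-val : Val (field-exp 1) k 3
      k-val = val-field 1 3 k-small
      q-val : Val (e ⊘ field-exp 0) q 1
      q-val = val-/ y-val b-val
      q≤ : q ≤ n / b
      q≤ = /-monoˡ-≤ b y≤n
      qb+y%b≡y : q * b + y % b ≡ y
      qb+y%b≡y = trans (+-comm (q * b) (y % b)) (sym (m≡m%n+[m/n]*n y b))
      start≤n : q / L * L * b ≤ n
      start≤n = ≤-trans (*-monoˡ-≤ b (m/n*n≤m q L)) (≤-trans (m/n*n≤m y b) y≤n)
      superblock-small : Small L 1 (superblock (q / L))
      superblock-small = small-cnt (member S) start≤n
      superblock-val : Val (peek (field-exp 2 ⊕ e ⊘ field-exp 0 ⊘ (word ⊘ lit 64) ⊗ (word ⊘ lit 64))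
                              (word ⊘ lit 64)) (superblock (q / L)) 1
      superblock-val = val-peek 1
        (val-+ (val-field 2 16 a₁-small) (val-* (val-/ q-val val-length) val-length)) val-length L≤w
        (Stored-array a₁ L (suc (n / b / L)) superblock (proj₁ (Stored-++ a₁ superblocks from₁))
           (s≤s (/-monoˡ-≤ L q≤)) (<2^L superblock-small))
        superblock-small
      offset-small : Small L 3 (offset q)
      offset-small = small-≤
        (≤-trans (cnt-≤ _ (q % L * b)) (*-mono-≤ (<⇒≤ (m%n<n q L)) b≤L))
        (small-weaken 3 (small-* small-L small-L))
      offset-val : Val (peek (field-exp 3 ⊕ e ⊘ field-exp 0 ⊗ field-exp 1) (field-exp 1)) (offset q) 3
      offset-val = val-peek 3
        (val-+ (val-field 3 16 a₂-small) (val-* q-val k-val)) k-val (≤-trans k≤2L (cL≤w 2))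
        (Stored-array a₂ k (suc (n / b)) offset (proj₁ (Stored-++ a₂ offsets from₂))
           (s≤s q≤) (offset< q))
        offset-small
      -- Only the `y % b` bits before `y` are read, so the access stays inside the bits of `S`.
      chunk = fromBits (y % b) (λ i → member S (q * b + i))
      chunk< : chunk < 2 ^ b
      chunk< = <-≤-trans (fromBits-< (y % b) _) (^-monoʳ-≤ 2 (<⇒≤ (m%n<n y b)))
      chunk-small : Small L 2 chunk
      chunk-small = small-≤ (<⇒≤ chunk<) (small-2^ b≤L)
      chunk-val : Val (peek (field-exp 4 ⊕ e ⊘ field-exp 0 ⊗ field-exp 0) (e ⊙ field-exp 0)) chunk 2
      chunk-val = val-peek 2
        (val-+ (val-field 4 16 a₃-small) (val-* q-val b-val)) (val-% y-val b-val)
        (≤-trans (<⇒≤ (m%n<n y b)) (≤-trans b≤L L≤w))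
        (fromBits-cong (y % b) λ i i< → trans (cong M (+-assoc a₃ (q * b) i))
          (Stored-member a₃ S (proj₁ (Stored-++ a₃ (Vec.toList S) from₃)) (q * b + i)
            (<-≤-trans (+-monoʳ-< (q * b) i<) (≤-trans (≤-reflexive qb+y%b≡y) y≤n))))
        chunk-small
      r = cnt (λ i → member S (q * b + i)) (y % b)
      popcount≡r : cnt (testBit chunk) b ≡ r
      popcount≡r = popcount _ (<⇒≤ (m%n<n y b))
      r-small : Small L 1 r
      r-small = small-cnt _ (≤-trans (m%n≤m y b) y≤n)
      r-val : Val (peek (field-exp 5 ⊕ peek (field-exp 4 ⊕ e ⊘ field-exp 0 ⊗ field-exp 0) (e ⊙ field-exp 0)
                          ⊗ (word ⊘ lit 64)) (word ⊘ lit 64)) r 1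
      r-val = val-peek 1
        (val-+ (val-field 5 16 a₄-small) (val-* chunk-val val-length)) val-length L≤w
        (trans (Stored-array a₄ L (2 ^ b) _ (proj₁ (Stored-++ a₄ popcounts from₄)) chunk<
                  (subst (_< 2 ^ L) (sym popcount≡r) (<2^L r-small)))
               popcount≡r)
        r-small
      sum : Val (rank-exp e) (superblock (q / L) + (offset q + r)) 5
      sum = val-+ superblock-val (val-+ offset-val r-val)

  rank-runs : ∀ x → Runs w M rankProgram (cost (rank-exp (var 0F ⊕ lit 1)) + 2)
                (toℕ x ∷ 0 ∷ 0 ∷ []) (rank x S ∷ 0 ∷ 0 ∷ [])
  rank-runs x = runs-≔ 0F (rank-exp (var 0F ⊕ lit 1)) (trans (value v) (sym (rank≡cnt x S)))
                  (subst (_< 2 ^ w) (sym (rank≡cnt x S)) (small⇒word (small v)))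
    where
    open Values {w} {L} w≡64L M (toℕ x ∷ 0 ∷ 0 ∷ [])
    x+1-val : Val (var 0F ⊕ lit 1) (suc (toℕ x)) 2
    x+1-val = subst (λ y → Val (var 0F ⊕ lit 1) y 2) (+-comm (toℕ x) 1)
                (val-+ (val-var 1 0F refl (small-≤n (<⇒≤ (toℕ<n x)))) (val-lit 1))
    v : Val (rank-exp (var 0F ⊕ lit 1)) (c (suc (toℕ x))) 1
    v = val-rank (toℕ<n x) x+1-val

  module _ (i : Fin ∣ S ∣) where

    private
      p q : ℕ
      p = toℕ (select S i)
      q = suc (toℕ i)

      p<n : p < n
      p<n = toℕ<n (select S i)

      q-small : Small L 1 q
      q-small = small-≤n (≤-trans (toℕ<n i) (∣p∣≤n S))

    advance : ℕ → ℕ → ℕ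
    advance y d = y + d * (bit (y + d <ᵇ suc n) * bit (c ((y + d) % suc n) <ᵇ q))

    advance-≤ : ∀ {y d} → y + d ≤ p → advance y d ≡ y + d
    advance-≤ {y} {d} z≤p
      rewrite <⇒<ᵇ≡ (s≤s (≤-trans z≤p (<⇒≤ p<n)))
            | m<n⇒m%n≡m {n = suc n} (s≤s (≤-trans z≤p (<⇒≤ p<n)))
            | select-<ᵇ S i (y + d)
            | <⇒<ᵇ≡ (s≤s z≤p) = cong (y +_) (*-identityʳ d)

    -- Up to `n` the rank test fails; beyond `n` the first factor vanishes.
    advance-> : ∀ {y d} → p < y + d → advance y d ≡ y
    advance-> {y} {d} p<z with y + d ≤? n
    ... | yes z≤N
      rewrite m<n⇒m%n≡m {n = suc n} (s≤s z≤N)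
            | select-<ᵇ S i (y + d)
            | ≥⇒<ᵇ≡ p<z
            | *-zeroʳ (bit (y + d <ᵇ suc n))
            | *-zeroʳ d = +-identityʳ y
    ... | no z≰N rewrite ≥⇒<ᵇ≡ (≰⇒> z≰N) | *-zeroʳ d = +-identityʳ y

    -- The window of length `2 * d` around `p` is cut in the middle, and the half with `p` is kept.
    advance-invariant : ∀ {y d} → y ≤ p → p < y + 2 * d → advance y d ≤ p × p < advance y d + d
    advance-invariant {y} {d} y≤p p< with y + d ≤? p
    ... | yes z≤p rewrite advance-≤ {y} {d} z≤p =
      z≤p , subst (p <_) (trans (cong (λ x → y + (d + x)) (+-identityʳ d)) (sym (+-assoc y d d))) p<
    ... | no z≰p rewrite advance-> {y} {d} (≰⇒> z≰p) = y≤p , ≰⇒> z≰p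

    body-runs : ∀ {y d} → y ≤ n → Small L 2 d →
                Runs w M searchBody bodyCost
                  (q ∷ y ∷ d ∷ []) (q ∷ advance y d ∷ d / 2 ∷ [])
    body-runs {y} {d} y≤n d-small =
      runs-⨾ (runs-≔ 1F advance-exp (value advance-val) (small⇒word (small advance-val)))
             (runs-≔ 2F (var 2F ⊘ lit 2) (V.value half-val) (V.small⇒word (V.small half-val)))
      where
      open Values {w} {L} w≡64L M (q ∷ y ∷ d ∷ [])
      module V = Values {w} {L} w≡64L M (q ∷ advance y d ∷ d ∷ [])
      z-val : Val (var 1F ⊕ var 2F) (y + d) 3
      z-val = val-+ (val-var 1 1F refl (small-≤n y≤n)) (val-var 2 2F refl d-small)
      N-val : Val (field-exp 7) (suc n) 2
      N-val = val-field 7 2 suc-n-small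
      z%N≤n : (y + d) % suc n ≤ n
      z%N≤n = m<1+n⇒m≤n (m%n<n (y + d) (suc n))
      advance-val : Val advance-exp (advance y d) 5
      advance-val = val-+ (val-var 1 1F refl (small-≤n y≤n))
        (val-* (val-var 2 2F refl d-small)
          (val-* (val-< z-val N-val)
            (val-< (val-rank z%N≤n (val-% z-val N-val)) (val-var 1 0F refl q-small))))
      half-val : V.Val (var 2F ⊘ lit 2) (d / 2) 2
      half-val = V.val-/ (V.val-var 2 2F refl d-small) (V.val-lit 2)

    loop-runs : ∀ e y → e < L → y ≤ p → p < y + 2 * 2 ^ e →
                Runs w M (while 2 searchBody) (suc e * suc bodyCost + 1)
                  (q ∷ y ∷ 2 ^ e ∷ []) (q ∷ p ∷ 0 ∷ [])
    loop-runs e y e<L y≤p p< = runs-weaken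
      (≤-reflexive (sym (+-assoc (suc bodyCost) (e * suc bodyCost) 1)))
      (runs-loop {ρ = q ∷ y ∷ 2 ^ e ∷ []} 2F (≢-nonZero⁻¹ (2 ^ e) {{m^n≢0 2 e}})
        (body-runs (≤-trans y≤p (<⇒≤ p<n)) (small-2^ (<⇒≤ e<L)))
        (rest e e<L (advance-invariant {y} {2 ^ e} y≤p p<)))
      where
      rest : ∀ e {y′} → e < L → y′ ≤ p × p < y′ + 2 ^ e →
             Runs w M (while 2 searchBody) (e * suc bodyCost + 1)
               (q ∷ y′ ∷ 2 ^ e / 2 ∷ []) (q ∷ p ∷ 0 ∷ [])
      -- The step has become `1 / 2 = 0`, which ends the loop, and a window of length 1 contains `p`
      -- alone.
      rest zero {y′} _ (lo , hi)
        rewrite ≤-antisym lo (m<1+n⇒m≤n (subst (p <_) (+-comm y′ 1) hi)) = runs-done 2F refl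
      rest (suc e) {y′} e<L (lo , hi) =
        subst (λ d → Runs w M (while 2 searchBody) (suc e * suc bodyCost + 1)
                      (q ∷ y′ ∷ d ∷ []) (q ∷ p ∷ 0 ∷ []))
          (sym (trans (cong (_/ 2) (*-comm 2 (2 ^ e))) (m*n/n≡m (2 ^ e) 2)))
          (loop-runs e y′ (<⇒≤ e<L) lo hi)

    select-runs-sparse : dense ≡ false →
      Runs w M selectProgram ((cost (field-exp 9) + 2) + suc (cost table-exp + 2))
        (q ∷ 0 ∷ 0 ∷ []) (p ∷ 0 ∷ 0 ∷ [])
    select-runs-sparse sparse =
      runs-⨾ (runs-≔ 2F (field-exp 9) (trans (value flag-val) (cong bit sparse)) (m^n>0 2 w))
        (runs-ifFalse 2F refl (runs-≔ 0F table-exp (value table-val) (small⇒word (small table-val))))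
      where
      module V = Values {w} {L} w≡64L M (q ∷ 0 ∷ 0 ∷ [])
      open V using (value; small; small⇒word)
      flag-val : V.Val (field-exp 9) (bit dense) 1
      flag-val = val-field 9 1 (small-bit dense)
      p-small : Small L 1 p
      p-small = small-≤n (<⇒≤ p<n)
      tableStored : Stored M a₅ (array L (suc ∣ S ∣) position)
      tableStored = subst (λ b → Stored M a₅ (if b then [] else array L (suc ∣ S ∣) position)) sparse from₅
      table-val : V.Val table-exp p 1
      table-val = V.val-peek 1
        (V.val-+ (val-field 6 16 a₅-small) (V.val-* (V.val-var 1 0F refl q-small) V.val-length))
        V.val-length L≤w
        (trans (Stored-array a₅ L (suc ∣ S ∣) position tableStored (s≤s (toℕ<n i))
                 (subst (_< 2 ^ L) (sym (position-select i)) (<2^L p-small)))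
               (position-select i))
        p-small

    select-runs-dense : dense ≡ true →
      Runs w M selectProgram
        ((cost (field-exp 9) + 2) +
         suc ((cost (field-exp 8) + 2) + ((L * suc bodyCost + 1) + (cost (var 1F) + 2))))
        (q ∷ 0 ∷ 0 ∷ []) (p ∷ p ∷ 0 ∷ [])
    select-runs-dense d =
      runs-⨾ (runs-≔ 2F (field-exp 9) (trans (V₀.value flag-val) (cong bit d))
                     (V₀.small⇒word (small-const 1 {1})))
        (runs-ifTrue 2F (λ ())
          (runs-⨾ (runs-≔ 2F (field-exp 8) (V₁.value top-val) (V₁.small⇒word (V₁.small top-val)))
            (runs-⨾ (subst (λ l → Runs w M (while 2 searchBody) (l * suc bodyCost + 1)
                                     (q ∷ 0 ∷ 2 ^ pred L ∷ []) (q ∷ p ∷ 0 ∷ []))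
                           (suc-pred L)
                           (loop-runs (pred L) 0 (≤-reflexive (suc-pred L)) z≤n
                             (<-≤-trans (<-trans p<n n<2^L)
                               (≤-reflexive (cong (2 ^_) (sym (suc-pred L)))))))
                    (runs-≔ 0F (var 1F) (V₂.value p-val) (V₂.small⇒word (V₂.small p-val))))))
      where
      module V₀ = Values {w} {L} w≡64L M (q ∷ 0 ∷ 0 ∷ [])
      module V₁ = Values {w} {L} w≡64L M (q ∷ 0 ∷ 1 ∷ [])
      module V₂ = Values {w} {L} w≡64L M (q ∷ p ∷ 0 ∷ [])
      flag-val : V₀.Val (field-exp 9) (bit dense) 1
      flag-val = val-field 9 1 (small-bit dense)
      top-val : V₁.Val (field-exp 8) (2 ^ pred L) 2
      top-val = val-field 8 2 (small-2^ pred[n]≤n)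
      p-val : V₂.Val (var 1F) p 1
      p-val = V₂.val-var 1 1F refl (small-≤n (<⇒≤ p<n))

-- Space

-- All but the bits of `S` is charged to the first two terms, with coefficients 2 and 165; 256 is a
-- round constant above both.
directorySize tableSize redundancy : ℕ → ℕ → ℕ
directorySize L n = n / blockSize L * offsetWidth L
tableSize L n     = 2 ^ blockSize L * L
redundancy L n    = 256 * (directorySize L n + tableSize L n)

module Size (L : ℕ) .{{_ : NonZero L}} {n} (S : Subset n) where

  open Layout L S

  private
    Y Z : ℕ
    Y = directorySize L n
    Z = tableSize L n

    L≤Z : L ≤ Z
    L≤Z = m≤n*m L (2 ^ b) {{m^n≢0 2 b}}

  dense⇒≤ : dense ≡ true → L ≤ g * g
  dense⇒≤ d = ≤ᵇ⇒≤ L (g * g) (subst T (sym d) tt)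

  sparse⇒∣S∣< : dense ≡ false → ∣ S ∣ < 2 ^ b
  sparse⇒∣S∣< s = <-≤-trans (n<2^suc⌊log₂n⌋ ∣ S ∣) (^-monoʳ-≤ 2 (s≤s g≤L/2))
    where
    g*g<L : g * g < L
    g*g<L = ≰⇒> λ L≤ → subst T s (≤⇒≤ᵇ L≤)
    -- `(g - 1)² ≥ 0` in the form that turns `g * g < L` into `g * 2 ≤ L`.
    2g≤ : ∀ g → g * 2 ≤ suc (g * g)
    2g≤ 0             = z≤n
    2g≤ 1             = ≤-refl
    2g≤ (suc (suc g)) = m≤n⇒m≤1+n (*-monoʳ-≤ (suc (suc g)) (s≤s (s≤s z≤n)))
    g≤L/2 : g ≤ L / 2
    g≤L/2 = subst (_≤ L / 2) (m*n/n≡m g 2) (/-monoˡ-≤ 2 (≤-trans (2g≤ g) g*g<L))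

  length-positions : length positions ≤ Z
  length-positions with dense in eq
  ... | true  = z≤n
  ... | false = ≤-trans (≤-reflexive (length-array L (suc ∣ S ∣) position))
                        (*-monoˡ-≤ L (sparse⇒∣S∣< eq))

  length-layout-≤ : length layout ≤ n + redundancy L n
  length-layout-≤ = begin
    length layout
      ≡⟨ length-layout ⟩
    a₁ + length superblocks + length offsets + length (Vec.toList S) + length popcounts
      + length positions
      ≤⟨ +-mono-≤ (+-mono-≤ (+-mono-≤ (+-mono-≤ (+-mono-≤ header≤ superblocks≤) offsets≤)
           (≤-reflexive (length-toList S))) (≤-reflexive (length-array L (2 ^ b) _))) length-positions ⟩
    160 * Z + (Z + Y) + (2 * Z + Y) + n + Z + Z
      ≡⟨ solve 3 (λ n Y Z → con 160 :* Z :+ (Z :+ Y) :+ (con 2 :* Z :+ Y) :+ n :+ Z :+ Z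
                   := n :+ (con 2 :* Y :+ con 165 :* Z)) refl n Y Z ⟩
    n + (2 * Y + 165 * Z)
      ≤⟨ +-monoʳ-≤ n (+-mono-≤ (*-monoˡ-≤ Y (m≤m+n 2 254)) (*-monoˡ-≤ Z (m≤m+n 165 91))) ⟩
    n + (256 * Y + 256 * Z)
      ≡⟨ cong (n +_) (*-distribˡ-+ 256 Y Z) ⟨
    n + redundancy L n ∎
    where
    open ≤-Reasoning
    open +-*-Solver
    header≤ : a₁ ≤ 160 * Z
    header≤ = ≤-trans (≤-reflexive (sym (*-assoc 10 16 L))) (*-monoʳ-≤ 160 L≤Z)
    -- `L` bits for every `L` blocks is one bit per block, no more than the `k` bits of its offset.
    superblocks≤ : length superblocks ≤ Z + Y
    superblocks≤ = ≤-trans (≤-reflexive (length-array L (suc (n / b / L)) superblock))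
      (+-mono-≤ L≤Z (≤-trans (m/n*n≤m (n / b) L) (m≤m*n (n / b) k)))
    offsets≤ : length offsets ≤ 2 * Z + Y
    offsets≤ = ≤-trans (≤-reflexive (length-array k (suc (n / b)) offset))
      (+-monoˡ-≤ Y (≤-trans k≤2L (*-monoʳ-≤ 2 L≤Z)))

  small-layout : n < 2 ^ L → Small L 16 (length layout)
  -- Degrees: 4 for the directory, 3 for the table, 5 for their sum, 14 after the factor 256, and 15
  -- with `n`.
  small-layout n< = small-weaken 16 (small-≤ length-layout-≤
    (small-+ n-small (small-* (small-const 9 {256})
      (small-+ Y-small (small-* (small-2^ b≤L) small-L)))))
    where
    n-small : Small L 1 n
    n-small = bounded (subst (λ x → n < 2 ^ x) (sym (*-identityˡ L)) n<)
    Y-small : Small L 4 Y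
    Y-small = small-≤ (*-mono-≤ (m/n≤m n b) k≤2L)
                (small-* n-small (small-* (small-const 2 {2}) small-L))

-- Growth estimates: the redundancy is sublinear

2^⌊log₂n⌋≤n : ∀ n → 1 ≤ n → 2 ^ ⌊log₂ n ⌋ ≤ n
2^⌊log₂n⌋≤n = <-rec (λ n → 1 ≤ n → 2 ^ ⌊log₂ n ⌋ ≤ n) step
  where
  open ≤-Reasoning
  step : ∀ n → (∀ {m} → m < n → 1 ≤ m → 2 ^ ⌊log₂ m ⌋ ≤ m) → 1 ≤ n → 2 ^ ⌊log₂ n ⌋ ≤ n
  step 1               rec _ = ≤-refl
  step n@(suc (suc m)) rec _ = begin
    2 ^ ⌊log₂ n ⌋             ≤⟨ ^-monoʳ-≤ 2 (m≤n+m∸n ⌊log₂ n ⌋ 1) ⟩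
    2 * 2 ^ (⌊log₂ n ⌋ ∸ 1)   ≡⟨ cong (λ l → 2 * 2 ^ l) (⌊log₂⌊n/2⌋⌋≡⌊log₂n⌋∸1 n) ⟨
    2 * 2 ^ ⌊log₂ ⌊ n /2⌋ ⌋   ≤⟨ *-monoʳ-≤ 2 (rec (⌊n/2⌋<n (suc m)) (s≤s z≤n)) ⟩
    2 * ⌊ n /2⌋               ≡⟨ cong (⌊ n /2⌋ +_) (+-identityʳ ⌊ n /2⌋) ⟩
    ⌊ n /2⌋ + ⌊ n /2⌋         ≤⟨ +-monoʳ-≤ ⌊ n /2⌋ (⌊n/2⌋≤⌈n/2⌉ n) ⟩
    ⌊ n /2⌋ + ⌈ n /2⌉         ≡⟨ ⌊n/2⌋+⌈n/2⌉≡n n ⟩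
    n ∎

2^m≤n⇒m≤⌊log₂n⌋ : ∀ {m n} → 2 ^ m ≤ n → m ≤ ⌊log₂ n ⌋
2^m≤n⇒m≤⌊log₂n⌋ {m} le = subst (_≤ _) (⌊log₂[2^n]⌋≡n m) (⌊log₂⌋-mono-≤ le)

-- From 4 on the square stays below the power: equality at 4, failure at 3.
[4+n]²≤2^[4+n] : ∀ n → (4 + n) * (4 + n) ≤ 2 ^ (4 + n)
[4+n]²≤2^[4+n] zero    = ≤-refl
[4+n]²≤2^[4+n] (suc n) = begin
  (1 + u) * (1 + u)
    ≡⟨ solve 1 (λ u → (con 1 :+ u) :* (con 1 :+ u) := u :* u :+ (con 2 :* u :+ con 1)) refl u ⟩
  u * u + (2 * u + 1)
    ≤⟨ +-monoʳ-≤ (u * u) (≤-trans (+-monoʳ-≤ (2 * u) (s≤s z≤n))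
         (≤-reflexive (+-comm (2 * u) u))) ⟩
  u * u + 3 * u      ≤⟨ +-monoʳ-≤ (u * u) (*-monoˡ-≤ u (m≤m+n 3 (suc n))) ⟩
  u * u + u * u      ≡⟨ cong (u * u +_) (+-identityʳ (u * u)) ⟨
  2 * (u * u)        ≤⟨ *-monoʳ-≤ 2 ([4+n]²≤2^[4+n] n) ⟩
  2 * 2 ^ u          ∎
  where
  open ≤-Reasoning
  open +-*-Solver
  u = 4 + n

linear≤exponential : ∀ k {u} → 4 + k ≤ u → k * u ≤ 2 ^ u
linear≤exponential k {u} le with m≤n⇒∃[o]m+o≡n (m+n≤o⇒m≤o 4 le)
... | v , refl = ≤-trans (*-monoˡ-≤ u (m+n≤o⇒n≤o 4 le)) ([4+n]²≤2^[4+n] v)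

L≤2b : ∀ L → L ≤ 2 * blockSize L
L≤2b L = begin
  L                     ≡⟨ m≡m%n+[m/n]*n L 2 ⟩
  L % 2 + L / 2 * 2     ≤⟨ +-monoˡ-≤ (L / 2 * 2) (m%n≤n L 2) ⟩
  2 + L / 2 * 2         ≡⟨ *-comm (blockSize L) 2 ⟩
  2 * blockSize L       ∎
  where open ≤-Reasoning

-- It suffices that `K * k ≤ b`, where `k` is logarithmic in `L` and `b` is linear.
offsets-sublinear : ∀ K {L} → 2 ^ (4 + 8 * K) ≤ L → ∀ n → K * directorySize L n ≤ n
offsets-sublinear K {L} L≥ n = begin
  K * (n / b * k)  ≡⟨ solve 3 (λ K q k → K :* (q :* k) := q :* (K :* k)) refl K (n / b) k ⟩
  n / b * (K * k)  ≤⟨ *-monoʳ-≤ (n / b) Kk≤b ⟩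
  n / b * b        ≤⟨ m/n*n≤m n b ⟩
  n                ∎
  where
  open ≤-Reasoning
  open +-*-Solver
  b = blockSize L
  k = offsetWidth L
  u = suc ⌊log₂ L ⌋
  Kk≤b : K * k ≤ b
  -- After multiplication by 4 the left side is `8 * K * u` and the right side at least `2 ^ u`;
  -- hence the 8 in the threshold.
  Kk≤b = *-cancelˡ-≤ 4 (begin
    4 * (K * (2 * u))   ≡⟨ solve 2 (λ K u → con 4 :* (K :* (con 2 :* u)) := con 8 :* K :* u) refl K u ⟩
    8 * K * u           ≤⟨ linear≤exponential (8 * K) (m≤n⇒m≤1+n (2^m≤n⇒m≤⌊log₂n⌋ L≥)) ⟩
    2 * 2 ^ ⌊log₂ L ⌋   ≤⟨ *-monoʳ-≤ 2 (2^⌊log₂n⌋≤n L (≤-trans (m^n>0 2 (4 + 8 * K)) L≥)) ⟩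
    2 * L               ≤⟨ *-monoʳ-≤ 2 (L≤2b L) ⟩
    2 * (2 * b)         ≡⟨ *-assoc 2 2 b ⟨
    4 * b               ∎)

-- The table takes about half of the exponent in `2 ^ L ≤ 2 * n`; the other half, `2 ^ v`, outgrows
-- any fixed multiple of `L`.
tables-sublinear : ∀ K n → 1 ≤ n → 2 ^ (4 + 8 * K) ≤ suc ⌊log₂ n ⌋ →
                   K * tableSize (suc ⌊log₂ n ⌋) n ≤ n
tables-sublinear K n 1≤n L≥ = *-cancelˡ-≤ 2 (begin
  2 * (K * (2 * 2 ^ h * L))    ≡⟨ solve 3 (λ K x L → con 2 :* (K :* (con 2 :* x :* L))
                                    := x :* (con 4 :* K :* L)) refl K (2 ^ h) L ⟩
  2 ^ h * (4 * K * L)          ≤⟨ *-monoʳ-≤ (2 ^ h) (*-monoʳ-≤ (4 * K) L≤2v) ⟩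
  2 ^ h * (4 * K * (2 * v))    ≡⟨ cong (2 ^ h *_) (solve 2 (λ K v → con 4 :* K :* (con 2 :* v)
                                    := con 8 :* K :* v) refl K v) ⟩
  2 ^ h * (8 * K * v)          ≤⟨ *-monoʳ-≤ (2 ^ h) (linear≤exponential (8 * K) x≤v) ⟩
  2 ^ h * 2 ^ v                ≡⟨ ^-distribˡ-+-* 2 h v ⟨
  2 ^ (h + v)                  ≡⟨ cong (2 ^_) (m+[n∸m]≡n (m/n≤m L 2)) ⟩
  2 * 2 ^ ⌊log₂ n ⌋            ≤⟨ *-monoʳ-≤ 2 (2^⌊log₂n⌋≤n n 1≤n) ⟩
  2 * n                        ∎)
  where
  open ≤-Reasoning
  open +-*-Solver
  L = suc ⌊log₂ n ⌋
  h = L / 2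
  v = L ∸ h
  x = 4 + 8 * K
  h≤v : h ≤ v
  h≤v = m+n≤o⇒m≤o∸n h (≤-trans (≤-reflexive (trans (cong (h +_) (sym (+-identityʳ h))) (*-comm 2 h)))
                                (m/n*n≤m L 2))
  L≤2v : L ≤ 2 * v
  L≤2v = begin
    L       ≡⟨ m+[n∸m]≡n (m/n≤m L 2) ⟨
    h + v   ≤⟨ +-monoˡ-≤ v h≤v ⟩
    v + v   ≡⟨ cong (v +_) (+-identityʳ v) ⟨
    2 * v   ∎
  -- The hypothesis gives `L ≥ 2 ^ x`, where `2 * x` would do; one threshold thus serves both
  -- estimates.
  x≤v : x ≤ v
  x≤v = *-cancelˡ-≤ 2 (begin
    2 * x   ≤⟨ *-monoˡ-≤ x (m≤m+n 2 (2 + 8 * K)) ⟩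
    x * x   ≤⟨ [4+n]²≤2^[4+n] (8 * K) ⟩
    2 ^ x   ≤⟨ L≥ ⟩
    L       ≤⟨ L≤2v ⟩
    2 * v   ∎)

redundancy-sublinear : LittleO (λ n → redundancy (suc ⌊log₂ n ⌋) n) (λ n → n)
-- `L` is logarithmic in `n` and must itself reach `2 ^ (4 + 8 * K)`, so the threshold is doubly
-- exponential.
redundancy-sublinear k = 2 ^ (2 ^ (4 + 8 * K)) , λ n N≤n →
  let L≥  = m≤n⇒m≤1+n (2^m≤n⇒m≤⌊log₂n⌋ N≤n)
      1≤n = ≤-trans (m^n>0 2 (2 ^ (4 + 8 * K))) N≤n
  in *-cancelˡ-≤ 2 (combine 256 (directorySize (suc ⌊log₂ n ⌋) n) (tableSize (suc ⌊log₂ n ⌋) n) n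
       (offsets-sublinear K L≥ n) (tables-sublinear K n 1≤n L≥))
  where
  -- 256 is the factor in `redundancy`; the 2 leaves half of `n` to each of the two terms.
  K = 2 * (k * 256)
  open ≤-Reasoning
  open +-*-Solver
  combine : ∀ c Y Z n → 2 * (k * c) * Y ≤ n → 2 * (k * c) * Z ≤ n → 2 * (k * (c * (Y + Z))) ≤ 2 * n
  combine c Y Z n Y≤ Z≤ = begin
    2 * (k * (c * (Y + Z)))
      ≡⟨ solve 4 (λ k c Y Z → con 2 :* (k :* (c :* (Y :+ Z)))
           := con 2 :* (k :* c) :* Y :+ con 2 :* (k :* c) :* Z) refl k c Y Z ⟩
    2 * (k * c) * Y + 2 * (k * c) * Z ≤⟨ +-mono-≤ Y≤ Z≤ ⟩
    n + n                             ≡⟨ cong (n +_) (+-identityʳ n) ⟨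
    2 * n                             ∎

-- The data structure and its time bounds

darray : DataStructure
darray = record
  { wordFactor = 64
  ; encode     = λ {n} S → Layout.layout (suc ⌊log₂ n ⌋) S
  ; rankProg   = rankProgram
  ; selectProg = selectProgram
  }

rankCost sparseCost : ℕ
rankCost   = cost (rank-exp (var 0F ⊕ lit 1)) + 2
sparseCost = (cost (field-exp 9) + 2) + suc (cost table-exp + 2)

denseCost : ℕ → ℕ
denseCost L = (cost (field-exp 9) + 2) +
  suc ((cost (field-exp 8) + 2) + ((L * suc bodyCost + 1) + (cost (var 1F) + 2)))

-- The cost has the form `A + c * L`, and `(A + c) * x` dominates both terms; `A + c` is the value
-- at 1.
denseCost-≤ : ∀ {L x} → 1 ≤ x → L ≤ x → denseCost L ≤ denseCost 1 * x
denseCost-≤ {L} {x} 1≤x L≤x = affine (cost (field-exp 9) + 2) (cost (field-exp 8) + 2) (suc bodyCost)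
    (cost (var 1F) + 2)
  where
  open ≤-Reasoning
  open +-*-Solver
  -- The costs are generalised to variables, so that the solver treats them as atoms instead of
  -- numerals.
  affine : ∀ a b c d → a + suc (b + ((L * c + 1) + d)) ≤ (a + suc (b + ((1 * c + 1) + d))) * x
  affine a b c d = begin
    a + suc (b + ((L * c + 1) + d))
      ≡⟨ solve 5 (λ a b c d L → a :+ (con 1 :+ (b :+ ((L :* c :+ con 1) :+ d)))
           := (a :+ (con 1 :+ (b :+ (con 1 :+ d)))) :* con 1 :+ c :* L) refl a b c d L ⟩
    (a + suc (b + suc d)) * 1 + c * L
      ≤⟨ +-mono-≤ (*-monoʳ-≤ (a + suc (b + suc d)) 1≤x) (*-monoʳ-≤ c L≤x) ⟩
    (a + suc (b + suc d)) * x + c * x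
      ≡⟨ solve 5 (λ a b c d x → (a :+ (con 1 :+ (b :+ (con 1 :+ d)))) :* x :+ c :* x
           := (a :+ (con 1 :+ (b :+ ((con 1 :* c :+ con 1) :+ d)))) :* x) refl a b c d x ⟩
    (a + suc (b + ((1 * c + 1) + d))) * x ∎

dense-selectBound : ∀ n m → suc ⌊log₂ n ⌋ ≤ ⌊log₂ m ⌋ * ⌊log₂ m ⌋ → suc ⌊log₂ n ⌋ ≤ selectBound n m
dense-selectBound n m L≤gg = m≤n⇒m≤1+n (begin
  L                 ≡⟨ m*n/n≡m L L ⟨
  L * L / L         ≤⟨ /-monoˡ-≤ L (*-mono-≤ L≤gg L≤gg) ⟩
  g * g * (g * g) / L ≡⟨ cong (_/ L) (solve 1 (λ g → g :* g :* (g :* g) := g :^ 4) refl g) ⟩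
  g ^ 4 / L         ∎)
  where
  open ≤-Reasoning
  open +-*-Solver
  L = suc ⌊log₂ n ⌋
  g = ⌊log₂ m ⌋

answers-weaken : ∀ {w p bs q a T U} → T ≤ U → Answers w p bs q a T → Answers w p bs q a U
answers-weaken T≤U ans M holds with ans M holds
... | t , s , t≤T , rest = t , s , ≤-trans t≤T T≤U , rest

module _ {n} (S : Subset n) where

  private
    L w : ℕ
    L = suc ⌊log₂ n ⌋
    w = 64 * L

    n<2^L : n < 2 ^ L
    n<2^L = n<2^suc⌊log₂n⌋ n

    ≤n⇒word : ∀ {x} → x ≤ n → x < 2 ^ w
    ≤n⇒word x≤n = ≤-<-trans x≤n (<-≤-trans n<2^L (^-monoʳ-≤ 2 (m≤n*m L 64)))

    module C M st = Correctness L S n<2^L (Size.small-layout L S n<2^L) refl M st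

  darray-rank : ∀ x → DataStructure.AnswersRank darray S x rankCost
  darray-rank x = runs⇒answers (≤n⇒word (<⇒≤ (toℕ<n x))) λ M st → _ , C.rank-runs M st x

  darray-select : ∀ i → DataStructure.AnswersSelect darray S i
                          ((sparseCost + denseCost 1) * selectBound n ∣ S ∣)
  darray-select i = byDensity (Layout.dense L S) refl
    where
    q≤n : suc (toℕ i) ≤ n
    q≤n = ≤-trans (toℕ<n i) (∣p∣≤n S)
    byDensity : ∀ d → Layout.dense L S ≡ d → DataStructure.AnswersSelect darray S i
                  ((sparseCost + denseCost 1) * selectBound n ∣ S ∣)
    byDensity false sparse = answers-weaken
      (≤-trans (m≤m+n sparseCost (denseCost 1))
               (m≤m*n (sparseCost + denseCost 1) (selectBound n ∣ S ∣)))
      (runs⇒answers (≤n⇒word q≤n) λ M st → _ , C.select-runs-sparse M st i sparse)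
    byDensity true d = answers-weaken
      (≤-trans (denseCost-≤ (s≤s z≤n) (dense-selectBound n ∣ S ∣ (Size.dense⇒≤ L S d)))
               (*-monoˡ-≤ (selectBound n ∣ S ∣) (m≤n+m (denseCost 1) sparseCost)))
      (runs⇒answers (≤n⇒word q≤n) λ M st → _ , C.select-runs-dense M st i d)

mainTheorem5 : Σ[ D ∈ DataStructure ] ∃[ r ] ∃[ C₁ ] ∃[ C₂ ]
    (LittleO r (λ n → n) ×
    (∀ n (S : Subset n) → 1 ≤ ∣ S ∣ →
    length (DataStructure.encode D S) ≤ n + r n ×
    (∀ (x : Fin n) → DataStructure.AnswersRank D S x C₁) ×
    (∀ (i : Fin ∣ S ∣) →
    DataStructure.AnswersSelect D S i (C₂ * selectBound n ∣ S ∣))))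
mainTheorem5 =
  darray , (λ n → redundancy (suc ⌊log₂ n ⌋) n) , rankCost , sparseCost + denseCost 1 ,
  redundancy-sublinear ,
  λ n S _ → Size.length-layout-≤ (suc ⌊log₂ n ⌋) S , darray-rank S , darray-select S
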